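{- For $n\ge 1$, the number $s_n^1(2413)$ of partial permutations of length $n$ with exactly one hole that avoid $2413$ equals $\frac{2}{n+1}\binom{2n}{n}-2^{n-1}$.
   Context: A partial permutation of length $n$ with one hole is a sequence $\pi_1\cdots\pi_n$ in which each of $1,\dots,n-1$ appears exactly once and the remaining entry is a hole symbol $\diamond$. A permutation $\sigma$ of $[n]$ is an extension of $\pi$ if the standardization (order-preserving relabeling by $1,2,\dots$) of the restriction of $\sigma$ to the non-hole positions equals the restriction of $\pi$ to those positions. $\pi$ avoids a pattern $p$ if every extension of $\pi$ avoids $p$ in the classical sense. -}

module Defs where

open import Data.Nat as ℕ using (ℕ; zero; suc; _<ᵇ_)
open import Data.Fin as Fin using (Fin; toℕ)
open import Data.Fin.Permutation using (Permutation′; _⟨$⟩ʳ_)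
open import Data.Maybe using (Maybe; just; nothing; is-just)
open import Data.Bool using (Bool; _∧_; T; T?)
open import Data.Vec using (Vec; lookup; _∷_; [])
open import Data.List using (List; length; filter; allFin)
open import Data.List.Membership.Propositional using (_∈_)
open import Data.List.Relation.Unary.Unique.Propositional using (Unique)
open import Data.Product using (Σ; ∃; ∃-syntax; _×_)
open import Relation.Binary.PropositionalEquality using (_≡_)
open import Function.Bundles using (_⇔_)

-- A partial permutation of length n = suc m with one hole is a word
-- π : Vec (Maybe (Fin m)) (suc m); `nothing` is the hole ◇ and
-- `just v` is the letter (toℕ v + 1) ∈ {1,…,n-1}.
Word : ℕ → Set
Word m = Vec (Maybe (Fin m)) (suc m)

IsPartialPerm1 : (m : ℕ) → Word m → Set
IsPartialPerm1 m π =
  (∃[ h ] (lookup π h ≡ nothing × (∀ j → lookup π j ≡ nothing → j ≡ h)))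
  × (∀ (v : Fin m) → ∃[ i ] (lookup π i ≡ just v × (∀ j → lookup π j ≡ just v → j ≡ i)))

-- number of non-hole positions j with σ j < σ i; this is (0-based) the value at
-- position i of the standardization of σ restricted to the non-hole positions
stdRank : ∀ {m} → Word m → Permutation′ (suc m) → Fin (suc m) → ℕ
stdRank {m} π σ i =
  length (filter (λ j → T? (is-just (lookup π j) ∧ (toℕ (σ ⟨$⟩ʳ j) <ᵇ toℕ (σ ⟨$⟩ʳ i))))
                 (allFin (suc m)))

IsExtension : ∀ {m} → Word m → Permutation′ (suc m) → Set
IsExtension {m} π σ = ∀ (i : Fin (suc m)) (v : Fin m) → lookup π i ≡ just v → stdRank π σ i ≡ toℕ v

Contains : ∀ {k n} → Vec ℕ k → Permutation′ n → Set
Contains {k} {n} p σ =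
  Σ (Fin k → Fin n) λ f →
    (∀ a b → a Fin.< b → f a Fin.< f b)
    × (∀ a b → (lookup p a ℕ.< lookup p b) ⇔ ((σ ⟨$⟩ʳ f a) Fin.< (σ ⟨$⟩ʳ f b)))

Avoids : ∀ {k n} → Vec ℕ k → Permutation′ n → Set
Avoids p σ = Contains p σ → Data.Empty.⊥
  where import Data.Empty

PAvoids : ∀ {k m} → Vec ℕ k → Word m → Set
PAvoids {m = m} p π = ∀ (σ : Permutation′ (suc m)) → IsExtension π σ → Avoids p σ

p2413 : Vec ℕ 4
p2413 = 2 ∷ 4 ∷ 1 ∷ 3 ∷ []

HasCard : {A : Set} → (A → Set) → ℕ → Set
HasCard {A} P c = Σ (List A) λ xs → Unique xs × (∀ x → (x ∈ xs) ⇔ P x) × length xs ≡ c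

{-# OPTIONS --safe #-}

-- Write a one-hole partial permutation as A ◇ B. It avoids 2413 iff none of the four patterns obtained from 2413 by
-- turning one letter into the hole occurs in it; in particular A avoids 231 and B avoids 312. This class is closed
-- under deleting the largest letter, so it is generated by a tree in which the children of a word arise by inserting
-- a new maximum. The positions where this is allowed depend only on a small label, so the number of words is the
-- number of nodes at level m of an explicit label tree. With c the Catalan series, the level generating function is
-- c² + (c - 1)² / (1 - 2x) = 2 c² - 1 / (1 - 2x).
module Submission where

open import Defs
open import Data.Nat using (ℕ; suc; _*_; _+_; _∸_; _^_; _/_)
open import Data.Nat.Combinatorics using (_C_)
open import Data.Product using (_×_)

open import Data.Bool using (Bool; true; false; T; T?; _∧_; if_then_else_)
open import Data.Bool.Properties using (T-∧)
open import Data.Empty using (⊥; ⊥-elim)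
open import Data.Fin as Fin using (Fin; toℕ; fromℕ; fromℕ<; inject₁; punchIn; punchOut; zero; suc)
open import Data.Fin.Patterns using (0F; 1F; 2F; 3F)
open import Data.Fin.Permutation using (Permutation′; permutation; _⟨$⟩ʳ_)
import Data.Fin.Properties as Finₚ
open import Data.List using (List; []; _∷_; _++_; [_]; allFin; concatMap; filter; length; map)
open import Data.List.Membership.Propositional using (_∈_; find)
open import Data.List.Membership.Propositional.Properties using
  (∈-allFin; ∈-concatMap⁺; ∈-concatMap⁻; ∈-filter⁺; ∈-filter⁻; ∈-map⁺; ∈-map⁻; ∈-∃++)
open import Data.List.Properties using
  ( ++-assoc; ++-identityʳ; filter-++; filter-accept; filter-all; filter-reject; length-filter; length-map
  ; length-tabulate; map-++; map-∘; ∷-injectiveʳ; ∷-injectiveˡ)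
open import Data.List.Relation.Binary.Permutation.Propositional using (_↭_; prep; ↭-refl; ↭-sym; ↭-trans; ↭⇒↭ₛ)
open import Data.List.Relation.Binary.Permutation.Propositional.Properties using
  (All-resp-↭; drop-∷; shift; ∈-resp-↭; ↭-length; ↭-singleton-inv)
import Data.List.Relation.Binary.Permutation.Setoid.Properties as Permₛ
open import Data.List.Relation.Unary.All as All using (All; []; _∷_)
import Data.List.Relation.Unary.All.Properties as Allₚ
open import Data.List.Relation.Unary.AllPairs as AllPairs using (AllPairs; []; _∷_)
import Data.List.Relation.Unary.AllPairs.Properties as AllPairsₚ
open import Data.List.Relation.Unary.Any as Any using (Any; here; there)
import Data.List.Relation.Unary.Any.Properties as Anyₚ
open import Data.List.Relation.Unary.Unique.Propositional using (Unique)
import Data.List.Relation.Unary.Unique.Propositional.Properties as Uniqueₚ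
open import Data.Maybe as Maybe using (Maybe; is-just; just; maybe′; nothing)
open import Data.Maybe.Properties using (map-injective; ≡-dec)
open import Data.Nat using (zero; z≤n; s≤s; _≤_; _<_; _≥_; _≟_; _<?_; _<ᵇ_)
open import Data.Nat.Combinatorics using (k>n⇒nCk≡0; nCk+nC[k+1]≡[n+1]C[k+1]; nCk≡nC[n∸k])
open import Data.Nat.DivMod using (m*n/n≡m)
open import Data.Nat.ListAction using (sum)
open import Data.Nat.ListAction.Properties using (sum-++)
open import Data.Nat.Properties
open import Data.Nat.Tactic.RingSolver using (solve-∀)
open import Data.Product using (_,_; ∃-syntax; proj₁; proj₂)
open import Data.Sum using (inj₁; inj₂)
open import Data.Unit using (tt)
open import Data.Vec using (Vec; []; _∷_; lookup)
open import Function using (id; _∘_)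
open import Function.Bundles using (Equivalence; mk⇔; _⇔_)
open import Relation.Binary.Definitions using (tri<; tri≈; tri>)
open import Relation.Binary.PropositionalEquality hiding ([_])
open import Relation.Nullary using (Dec; yes; no; does; ¬_; ¬?)
open import Relation.Nullary.Decidable using (False; True; dec-false; dec-true; map′; toWitness; toWitnessFalse; _×-dec_)
open import Relation.Unary using (Decidable)

-- The label tree and its level sizes

-- A new maximum can only play the largest letter of a forbidden pattern, so whether a cut admits it
-- depends on comparisons between the two sides of the cut and across the hole. In `B`, the letters
-- right of the cut must decrease and those left of it must lie above `A`. In `A`, the letters left
-- of the cut must lie below those right of it and above `B`. An ascent in `B` therefore closes the
-- front of `B` for good, which is why every label carries the flag `f`. The `false` labels give
-- powers of c, possibly divided by 1 - x; the `true` labels exceed them by terms with denominator 1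
-- - 2x. That denominator comes from `leftTop true`: it and its child `rightTop true 1` both contain
-- `weighted k 0`, so this term doubles from one level to the next, with a ballot number added.
-- Series are handled through their coefficients. The relation c = 1 + x c² appears as `ballot (suc
-- k) (suc t) = ballot k (suc (suc t)) + ballot (suc k) t`, which holds by definition.

sumTo : (ℕ → ℕ) → ℕ → ℕ
sumTo φ zero    = φ 0
sumTo φ (suc t) = φ (suc t) + sumTo φ t

sumTo-cong : ∀ {φ ψ} → (∀ s → φ s ≡ ψ s) → ∀ t → sumTo φ t ≡ sumTo ψ t
sumTo-cong e zero    = e 0
sumTo-cong e (suc t) = cong₂ _+_ (e (suc t)) (sumTo-cong e t)

sumTo-+ : ∀ φ ψ t → sumTo (λ s → φ s + ψ s) t ≡ sumTo φ t + sumTo ψ t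
sumTo-+ φ ψ zero    = refl
sumTo-+ φ ψ (suc t) rewrite sumTo-+ φ ψ t = lem (φ (suc t)) (ψ (suc t)) (sumTo φ t) (sumTo ψ t)
  where
  lem : ∀ a b c d → a + b + (c + d) ≡ a + c + (b + d)
  lem = solve-∀

sumTo-shift : ∀ φ t → sumTo φ (suc t) ≡ φ 0 + sumTo (λ s → φ (suc s)) t
sumTo-shift φ zero    = +-comm (φ 1) (φ 0)
sumTo-shift φ (suc t) rewrite sumTo-shift φ t =
  lem (φ (suc (suc t))) (φ 0) (sumTo (λ s → φ (suc s)) t)
  where
  lem : ∀ a b c → a + (b + c) ≡ b + (a + c)
  lem = solve-∀

-- A label records how the largest letters are distributed over A ◇ B:
--   leftEmpty f t  A is empty
--   rightTop f t   the maximum is in B, and some letter of A is smaller than some letter of B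
--   leftTop f      the maximum is in A, and some letter of A is smaller than some letter of B
--   leftAbove f p  A is nonempty and above B; p + 1 positions in A admit a new maximum
-- where f says whether B is decreasing and t + 1 positions in B admit a new maximum.
data State : Set where
  leftEmpty  : Bool → ℕ → State
  rightTop   : Bool → ℕ → State
  leftTop    : Bool → State
  leftAbove  : Bool → ℕ → State

-- Insertion in front of a decreasing `B` keeps it decreasing and lengthens the admissible run by
-- one. Every other cut makes the maximum the top of a new last ascent; the run is then the maximum
-- and the `s` run letters behind it, hence `suc s`. With `false`, even the first admissible cut is
-- of this second kind.
tailSum : (Bool → ℕ → ℕ) → Bool → ℕ → ℕ
tailSum φ false t       = sumTo (λ s → φ false (suc s)) t
tailSum φ true  zero    = φ true 1
tailSum φ true  (suc t) = φ true (suc (suc t)) + sumTo (λ s → φ false (suc s)) t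

descendants : ℕ → State → ℕ
descendants zero    _               = 1
descendants (suc k) (leftEmpty f t) =
  descendants k (leftAbove f 1) + tailSum (λ f′ t′ → descendants k (leftEmpty f′ t′)) f t
descendants (suc k) (rightTop f t)  =
  descendants k (leftTop f) + tailSum (λ f′ t′ → descendants k (rightTop f′ t′)) f t
descendants (suc k) (leftTop f)     =
  descendants k (leftTop f) + (if f then descendants k (rightTop true 1) else 0)
descendants (suc k) (leftAbove f p) =
  sumTo (λ q → descendants k (leftAbove f (suc q))) p + (if f then descendants k (rightTop true 1) else 0)

-- In the variable k, with c the Catalan series, ballot k t has generating function c^(t+1), weighted k j has
-- (c^(j+1) - c^j) / (1 - 2x), and emptyExcess k has (c - 1)² / (1 - 2x).
ballot : ℕ → ℕ → ℕ
ballot zero    t = 1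
ballot (suc k) t = sumTo (λ s → ballot k (suc s)) t

ballotSum : ℕ → ℕ → ℕ
ballotSum zero    t = 1
ballotSum (suc k) t = ballot (suc k) t + ballotSum k t

weighted : ℕ → ℕ → ℕ
weighted zero    j = 0
weighted (suc k) j = 2 * weighted k j + ballot k (suc j)

weightedSum : ℕ → ℕ
weightedSum zero    = 0
weightedSum (suc k) = weightedSum k + weighted k 0

aboveExcess : ℕ → ℕ → ℕ
aboveExcess zero    p = 0
aboveExcess (suc k) p = ballot k (suc (suc p)) + weighted k (suc p)

emptyExcess : ℕ → ℕ
emptyExcess zero    = 0
emptyExcess (suc k) = emptyExcess k + aboveExcess k 1

descendants-leftAbove-false : ∀ k p → descendants k (leftAbove false p) ≡ ballot k p
descendants-leftAbove-false zero    p = refl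
descendants-leftAbove-false (suc k) p =
  trans (+-identityʳ _) (sumTo-cong (λ q → descendants-leftAbove-false k (suc q)) p)

descendants-leftEmpty-false : ∀ k t → descendants k (leftEmpty false t) ≡ ballot k (suc t)
descendants-leftEmpty-false zero    t = refl
descendants-leftEmpty-false (suc k) t
  rewrite descendants-leftAbove-false k 1
        | sumTo-cong (λ s → descendants-leftEmpty-false k (suc s)) t
        = sym (sumTo-shift (λ s → ballot k (suc s)) t)

descendants-leftTop-false : ∀ k → descendants k (leftTop false) ≡ 1
descendants-leftTop-false zero    = refl
descendants-leftTop-false (suc k) rewrite descendants-leftTop-false k = refl

-- This is the recursion of `ballot` summed over all levels; the extra 1 is the bottom term
-- `ballot 0 t`, and in the tree it is the value of the child `leftTop false`.
ballotSum-step : ∀ k t → suc (sumTo (λ s → ballotSum k (suc s)) t) ≡ ballotSum (suc k) t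
ballotSum-step zero    t = +-comm 1 (ballot 1 t)
ballotSum-step (suc k) t =
  trans (cong suc (sumTo-+ (λ s → ballot (suc k) (suc s)) (λ s → ballotSum k (suc s)) t))
  (trans (sym (+-suc _ _)) (cong (ballot (suc (suc k)) t +_) (ballotSum-step k t)))

descendants-rightTop-false : ∀ k t → descendants k (rightTop false t) ≡ ballotSum k t
descendants-rightTop-false zero    t = refl
descendants-rightTop-false (suc k) t
  rewrite descendants-leftTop-false k
        | sumTo-cong (λ s → descendants-rightTop-false k (suc s)) t
        = ballotSum-step k t

-- With W = (c - 1) / (1 - 2x) this reads c² / (1 - x) + x W / (1 - x) = c² + W, which is c - 1 = x
-- c² after clearing denominators.
ballotSum-weighted : ∀ k → ballotSum k 1 + weightedSum k ≡ ballot k 1 + weighted k 0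
ballotSum-weighted zero    = refl
ballotSum-weighted (suc k) =
  trans (lem (ballot (suc k) 1) (ballotSum k 1) (weightedSum k) (weighted k 0))
  (trans (cong (λ z → ballot (suc k) 1 + (z + weighted k 0)) (ballotSum-weighted k))
         (cong (ballot (suc k) 1 +_) (lem′ (ballot k 1) (weighted k 0))))
  where
  lem : ∀ a b c d → (a + b) + (c + d) ≡ a + ((b + c) + d)
  lem = solve-∀
  lem′ : ∀ a b → a + b + b ≡ 2 * b + a
  lem′ = solve-∀

mutual
  descendants-leftTop-true : ∀ k → descendants k (leftTop true) ≡ suc (weighted k 0)
  descendants-leftTop-true zero    = refl
  descendants-leftTop-true (suc k)
    rewrite descendants-leftTop-true k | descendants-rightTop-true-1 k
          = cong suc (lem (weighted k 0) (ballot k 1))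
    where
    lem : ∀ a b → a + (b + a) ≡ 2 * a + b
    lem = solve-∀

  descendants-rightTop-true-1 : ∀ k → descendants k (rightTop true 1) ≡ ballot k 1 + weighted k 0
  descendants-rightTop-true-1 k = trans (descendants-rightTop-true k 1) (ballotSum-weighted k)

  -- The excess over `rightTop false t` is the same for all `t`: one child keeps the form
  -- `rightTop true`, and at each level the child `leftTop true` exceeds `leftTop false` by
  -- `weighted k 0`. `weightedSum` collects these amounts.
  descendants-rightTop-true : ∀ k t → descendants k (rightTop true t) ≡ ballotSum k t + weightedSum k
  descendants-rightTop-true zero    t = refl
  descendants-rightTop-true (suc k) zero
    rewrite descendants-leftTop-true k | descendants-rightTop-true k 1 | sym (ballotSum-step k 0)
          = cong suc (lem (weighted k 0) (ballotSum k 1) (weightedSum k))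
    where
    lem : ∀ a b c → a + (b + c) ≡ b + (c + a)
    lem = solve-∀
  descendants-rightTop-true (suc k) (suc t)
    rewrite descendants-leftTop-true k | descendants-rightTop-true k (suc (suc t))
          | sumTo-cong (λ s → descendants-rightTop-false k (suc s)) t
          | sym (ballotSum-step k (suc t))
          = cong suc (lem (weighted k 0) (ballotSum k (suc (suc t))) (weightedSum k)
                          (sumTo (λ s → ballotSum k (suc s)) t))
    where
    lem : ∀ a b c d → a + (b + c + d) ≡ b + d + (c + a)
    lem = solve-∀

-- The recursion of `ballot`, c^(j+2) = c^(j+1) + x c^(j+3), survives multiplication by x c / (1 -
-- 2x).
weighted-suc : ∀ k j → weighted (suc k) (suc j) ≡ weighted (suc k) j + weighted k (suc (suc j))
weighted-suc zero    j = refl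
weighted-suc (suc k) j =
  trans (cong (λ z → 2 * z + ballot (suc k) (suc (suc j))) (weighted-suc k j))
        (lem (weighted (suc k) j) (weighted k (suc (suc j)))
             (ballot k (suc (suc (suc j)))) (ballot (suc k) (suc j)))
  where
  lem : ∀ a b c d → 2 * (a + b) + (c + d) ≡ 2 * a + d + (2 * b + c)
  lem = solve-∀

-- This is the recursion of `leftAbove true` minus that of `leftAbove false`; the added term is the
-- subtree of the extra child `rightTop true 1`. Raising `p` adds one summand on the left, which on
-- the right is one step of `ballot` together with `weighted-suc`.
aboveExcess-step : ∀ k p → sumTo (λ q → aboveExcess k (suc q)) p + (ballot k 1 + weighted k 0)
                   ≡ aboveExcess (suc k) p
aboveExcess-step zero p = cong (_+ 1) (zeros p)
  where
  zeros : ∀ p → sumTo (λ _ → 0) p ≡ 0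
  zeros zero    = refl
  zeros (suc p) = zeros p
aboveExcess-step (suc k) zero
  rewrite weighted-suc k 0 =
  lem (ballot k 3) (weighted k 2) (ballot (suc k) 1) (weighted (suc k) 0)
  where
  lem : ∀ a b c d → a + b + (c + d) ≡ a + c + (d + b)
  lem = solve-∀
aboveExcess-step (suc k) (suc p) =
  trans (+-assoc (aboveExcess (suc k) (suc (suc p))) _ _)
  (trans (cong (aboveExcess (suc k) (suc (suc p)) +_) (aboveExcess-step (suc k) p))
  (trans (lem (ballot k (suc (suc (suc (suc p))))) (weighted k (suc (suc (suc p)))) (ballot (suc k) (suc (suc p))) (weighted (suc k) (suc p)))
         (cong (ballot (suc k) (suc (suc (suc p))) +_) (sym (weighted-suc k (suc p))))))
  where
  lem : ∀ a b c d → a + b + (c + d) ≡ a + c + (d + b)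
  lem = solve-∀

descendants-leftAbove-true : ∀ k p → descendants k (leftAbove true p) ≡ ballot k p + aboveExcess k p
descendants-leftAbove-true zero    p = refl
descendants-leftAbove-true (suc k) p
  rewrite descendants-rightTop-true-1 k
        | sumTo-cong (λ q → descendants-leftAbove-true k (suc q)) p
        | sumTo-+ (λ q → ballot k (suc q)) (λ q → aboveExcess k (suc q)) p
        = trans (+-assoc (ballot (suc k) p) _ _) (cong (ballot (suc k) p +_) (aboveExcess-step k p))

descendants-leftEmpty-true : ∀ k t → descendants k (leftEmpty true t) ≡ ballot k (suc t) + emptyExcess k
descendants-leftEmpty-true zero    t = refl
descendants-leftEmpty-true (suc k) zero
  rewrite descendants-leftAbove-true k 1 | descendants-leftEmpty-true k 1
        = lem (ballot k 1) (aboveExcess k 1) (ballot k 2) (emptyExcess k)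
  where
  lem : ∀ a b c d → a + b + (c + d) ≡ c + a + (d + b)
  lem = solve-∀
descendants-leftEmpty-true (suc k) (suc t)
  rewrite descendants-leftAbove-true k 1 | descendants-leftEmpty-true k (suc (suc t))
        | sumTo-cong (λ s → descendants-leftEmpty-false k (suc s)) t
        | sumTo-shift (λ s → ballot k (suc s)) t
        = lem (ballot k 1) (aboveExcess k 1) (ballot k (suc (suc (suc t)))) (emptyExcess k)
              (sumTo (λ s → ballot k (suc (suc s))) t)
  where
  lem : ∀ a b c d e → a + b + (c + d + e) ≡ c + (a + e) + (d + b)
  lem = solve-∀

-- Since (c - 1)² = x² c⁴, both sides have the series x c⁴ / (1 - 2x).
emptyExcess-weighted : ∀ k → emptyExcess (suc k) ≡ weighted k 2
emptyExcess-weighted zero    = refl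
emptyExcess-weighted (suc k) rewrite emptyExcess-weighted k = lem (weighted k 2) (ballot k 3)
  where
  lem : ∀ a b → a + (b + a) ≡ 2 * a + b
  lem = solve-∀

-- Both terms on the left double at each level, up to the summand `ballot k 3`. Two unfoldings of
-- `ballot` show that the right side does the same.
weighted-ballot : ∀ k → weighted k 2 + 2 ^ suc k ≡ ballot (suc k) 1
weighted-ballot zero    = refl
weighted-ballot (suc k) =
  trans (lem (weighted k 2) (2 ^ suc k) (ballot k 3))
  (trans (cong (λ z → 2 * z + ballot k 3) (weighted-ballot k))
         (lem′ (ballot (suc k) 1) (ballot k 3)))
  where
  lem : ∀ a b c → 2 * a + c + (b + (b + 0)) ≡ 2 * (a + b) + c
  lem = solve-∀
  lem′ : ∀ a b → 2 * a + b ≡ b + a + a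
  lem′ = solve-∀

emptyExcess-ballot : ∀ k → emptyExcess k + 2 ^ k ≡ ballot k 1
emptyExcess-ballot zero    = refl
emptyExcess-ballot (suc k) rewrite emptyExcess-weighted k = weighted-ballot k

-- C (2k + t) (k - 1), which is 0 for k = 0
ballotDefect : ℕ → ℕ → ℕ
ballotDefect zero    t = 0
ballotDefect (suc k) t = (2 * suc k + t) C k

-- Ballot numbers as differences of binomial coefficients, and the Catalan numbers

pascal : ∀ n k → suc n C suc k ≡ n C k + n C suc k
pascal n k = sym (nCk+nC[k+1]≡[n+1]C[k+1] n k)

ballotDefect-pascal : ∀ k t → ((2 * k + t) C k) + ballotDefect k t ≡ (suc (2 * k + t)) C k
ballotDefect-pascal zero    t = refl
ballotDefect-pascal (suc k) t = trans (+-comm ((2 * suc k + t) C suc k) _) (sym (pascal (2 * suc k + t) k))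

-- The reflection formula for ballot numbers, written additively to avoid truncated subtraction. For
-- `t > 0`, Pascal's rule turns the binomial side into the recursion of `ballot`.
ballot-binomial : ∀ k t → ballot k t + ballotDefect k t ≡ (2 * k + t) C k
ballot-binomial zero    t    = refl
ballot-binomial (suc k) zero = begin
  ballot k 1 + (2 * suc k + 0) C k
    ≡⟨ cong (λ z → ballot k 1 + z C k) (n₀ k) ⟩
  ballot k 1 + suc (2 * k + 1) C k
    ≡⟨ cong (ballot k 1 +_) (sym (ballotDefect-pascal k 1)) ⟩
  ballot k 1 + ((2 * k + 1) C k + ballotDefect k 1)
    ≡⟨ lem (ballot k 1) ((2 * k + 1) C k) (ballotDefect k 1) ⟩
  (2 * k + 1) C k + (ballot k 1 + ballotDefect k 1)
    ≡⟨ cong ((2 * k + 1) C k +_) (ballot-binomial k 1) ⟩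
  (2 * k + 1) C k + (2 * k + 1) C k
    -- The boundary case rests on the equality of the two middle entries of row 2k + 1.
    ≡⟨ cong ((2 * k + 1) C k +_) symm ⟩
  (2 * k + 1) C k + (2 * k + 1) C suc k
    ≡⟨ sym (pascal (2 * k + 1) k) ⟩
  suc (2 * k + 1) C suc k
    ≡⟨ cong (_C suc k) (sym (n₀ k)) ⟩
  (2 * suc k + 0) C suc k ∎
  where
  open ≡-Reasoning
  n₀ : ∀ k → 2 * suc k + 0 ≡ suc (2 * k + 1)
  n₀ = solve-∀
  n₁ : ∀ k → 2 * k + 1 ≡ suc k + k
  n₁ = solve-∀
  lem : ∀ a b c → a + (b + c) ≡ b + (a + c)
  lem = solve-∀
  symm : (2 * k + 1) C k ≡ (2 * k + 1) C suc k
  symm rewrite n₁ k = trans (nCk≡nC[n∸k] (m≤n+m k (suc k))) (cong (λ z → (suc k + k) C z) (m+n∸n≡m (suc k) k))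
ballot-binomial (suc k) (suc t) = begin
  ballot k (suc (suc t)) + ballot (suc k) t + (2 * suc k + suc t) C k
    ≡⟨ cong (λ z → ballot k (suc (suc t)) + ballot (suc k) t + z) split ⟩
  ballot k (suc (suc t)) + ballot (suc k) t + ((2 * suc k + t) C k + ballotDefect k (suc (suc t)))
    ≡⟨ lem (ballot k (suc (suc t))) (ballot (suc k) t) ((2 * suc k + t) C k) (ballotDefect k (suc (suc t))) ⟩
  (ballot k (suc (suc t)) + ballotDefect k (suc (suc t))) + (ballot (suc k) t + (2 * suc k + t) C k)
    ≡⟨ cong₂ _+_ (ballot-binomial k (suc (suc t))) (ballot-binomial (suc k) t) ⟩
  (2 * k + suc (suc t)) C k + (2 * suc k + t) C suc k
    ≡⟨ cong (λ z → z C k + (2 * suc k + t) C suc k) (n₁ k t) ⟩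
  (2 * suc k + t) C k + (2 * suc k + t) C suc k
    ≡⟨ sym (pascal (2 * suc k + t) k) ⟩
  suc (2 * suc k + t) C suc k
    ≡⟨ cong (_C suc k) (sym (+-suc (2 * suc k) t)) ⟩
  (2 * suc k + suc t) C suc k ∎
  where
  open ≡-Reasoning
  n₁ : ∀ k t → 2 * k + suc (suc t) ≡ 2 * suc k + t
  n₁ = solve-∀
  lem : ∀ a b c d → a + b + (c + d) ≡ (a + d) + (b + c)
  lem = solve-∀
  split : (2 * suc k + suc t) C k ≡ (2 * suc k + t) C k + ballotDefect k (suc (suc t))
  split = trans (cong (_C k) (trans (+-suc (2 * suc k) t) (cong suc (sym (n₁ k t)))))
          (trans (sym (ballotDefect-pascal k (suc (suc t))))
                 (cong (λ z → z C k + ballotDefect k (suc (suc t))) (n₁ k t)))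

absorption : ∀ n k → suc k * (suc n C suc k) ≡ suc n * (n C k)
absorption zero    zero    = refl
absorption zero    (suc k) = trans (cong (suc (suc k) *_) (k>n⇒nCk≡0 {1} {suc (suc k)} (s≤s (s≤s z≤n)))) (*-zeroʳ (suc (suc k)))
absorption (suc n) zero    = begin
  1 * (suc (suc n) C 1)              ≡⟨ *-identityˡ _ ⟩
  suc (suc n) C 1                    ≡⟨ pascal (suc n) 0 ⟩
  suc (suc n C 1)                    ≡⟨ cong suc (sym (*-identityˡ (suc n C 1))) ⟩
  suc (1 * (suc n C 1))              ≡⟨ cong suc (absorption n zero) ⟩
  suc (suc n * 1)                    ≡⟨⟩
  suc (suc n) * 1                    ∎
  where open ≡-Reasoning
absorption (suc n) (suc k) = begin
  suc (suc k) * (suc (suc n) C suc (suc k))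
    ≡⟨ cong (suc (suc k) *_) (pascal (suc n) (suc k)) ⟩
  suc (suc k) * (suc n C suc k + suc n C suc (suc k))
    ≡⟨ lem (suc k) (suc n C suc k) (suc n C suc (suc k)) ⟩
  suc n C suc k + (suc k * (suc n C suc k) + suc (suc k) * (suc n C suc (suc k)))
    ≡⟨ cong (suc n C suc k +_) (cong₂ _+_ (absorption n k) (absorption n (suc k))) ⟩
  suc n C suc k + (suc n * (n C k) + suc n * (n C suc k))
    ≡⟨ cong (suc n C suc k +_) (sym (*-distribˡ-+ (suc n) (n C k) (n C suc k))) ⟩
  suc n C suc k + suc n * (n C k + n C suc k)
    ≡⟨ cong (λ z → suc n C suc k + suc n * z) (sym (pascal n k)) ⟩
  suc (suc n) * (suc n C suc k) ∎
  where
  open ≡-Reasoning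
  lem : ∀ a b c → suc a * (b + c) ≡ b + (a * b + suc a * c)
  lem = solve-∀

C-sym : ∀ a b → (a + b) C a ≡ (a + b) C b
C-sym a b = trans (nCk≡nC[n∸k] (m≤m+n a b)) (cong (λ z → (a + b) C z) (m+n∸m≡n a b))

-- For positive `m`, absorption reduces the left side to (2m + 1) C(2m, m - 1) and the right side to
-- (2m + 1) C(2m, m + 1), which agree by symmetry.
ballotDefect-ratio : ∀ m → m * ((2 * m + 1) C m) ≡ suc (suc m) * ballotDefect m 1
ballotDefect-ratio zero    = refl
ballotDefect-ratio (suc k) = begin
  suc k * ((2 * suc k + 1) C suc k)              ≡⟨ cong (λ z → suc k * (z C suc k)) (n₀ k) ⟩
  suc k * (suc (suc (suc k) + k) C suc k)        ≡⟨ absorption (suc (suc k) + k) k ⟩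
  suc (suc (suc k) + k) * ((suc (suc k) + k) C k)
    ≡⟨ cong (suc (suc (suc k) + k) *_) (sym (C-sym (suc (suc k)) k)) ⟩
  suc (suc (suc k) + k) * ((suc (suc k) + k) C suc (suc k)) ≡⟨ sym (absorption (suc (suc k) + k) (suc (suc k))) ⟩
  suc (suc (suc k)) * (suc (suc (suc k) + k) C suc (suc (suc k)))
    ≡⟨ cong (suc (suc (suc k)) *_) (C-sym (suc (suc (suc k))) k) ⟩
  suc (suc (suc k)) * ((suc (suc (suc k)) + k) C k) ≡⟨ cong (λ z → suc (suc (suc k)) * (z C k)) (sym (n₀ k)) ⟩
  suc (suc (suc k)) * ((2 * suc k + 1) C k) ∎
  where
  open ≡-Reasoning
  n₀ : ∀ k → 2 * suc k + 1 ≡ suc (suc (suc k) + k)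
  n₀ = solve-∀

central-double : ∀ m → (2 * suc m) C suc m ≡ (2 * m + 1) C m + (2 * m + 1) C m
central-double m = begin
  (2 * suc m) C suc m                           ≡⟨ cong (_C suc m) (n₀ m) ⟩
  suc (m + suc m) C suc m                       ≡⟨ pascal (m + suc m) m ⟩
  (m + suc m) C m + (m + suc m) C suc m         ≡⟨ cong ((m + suc m) C m +_) (sym (C-sym m (suc m))) ⟩
  (m + suc m) C m + (m + suc m) C m             ≡⟨ cong (λ z → z C m + z C m) (sym (n₁ m)) ⟩
  (2 * m + 1) C m + (2 * m + 1) C m             ∎
  where
  open ≡-Reasoning
  n₀ : ∀ m → 2 * suc m ≡ suc (m + suc m)
  n₀ = solve-∀
  n₁ : ∀ m → 2 * m + 1 ≡ m + suc m
  n₁ = solve-∀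

-- `ballot m 1` is the Catalan number of index m + 1, as c² = (c - 1) / x. With `a = b + d` and
-- `m * a = (m + 2) * d`, multiplying `b` by m + 2 leaves exactly 2a; the `d` terms are cancelled
-- from both sides.
ballot-catalan : ∀ m → ballot m 1 * (suc m + 1) ≡ (2 * suc m) C suc m
ballot-catalan m = trans (+-cancelʳ-≡ (ballotDefect m 1 * suc (suc m)) _ _ (begin
  b * (suc m + 1) + d * suc (suc m)  ≡⟨ lem b d m ⟩
  suc (suc m) * (b + d)              ≡⟨ cong (suc (suc m) *_) (ballot-binomial m 1) ⟩
  suc (suc m) * a                    ≡⟨ lem′ a m ⟩
  a + a + m * a                      ≡⟨ cong (a + a +_) (ballotDefect-ratio m) ⟩
  a + a + suc (suc m) * d            ≡⟨ cong (a + a +_) (*-comm (suc (suc m)) d) ⟩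
  a + a + d * suc (suc m)            ∎)) (sym (central-double m))
  where
  open ≡-Reasoning
  a = (2 * m + 1) C m
  b = ballot m 1
  d = ballotDefect m 1
  lem : ∀ b d m → b * (suc m + 1) + d * suc (suc m) ≡ suc (suc m) * (b + d)
  lem = solve-∀
  lem′ : ∀ a m → suc (suc m) * a ≡ a + a + m * a
  lem′ = solve-∀

descendants-root : ∀ m → descendants m (leftEmpty true 0) ≡ (2 * ((2 * suc m) C suc m)) / (suc m + 1) ∸ 2 ^ m
descendants-root m = begin
  descendants m (leftEmpty true 0)                     ≡⟨ descendants-leftEmpty-true m 0 ⟩
  ballot m 1 + emptyExcess m                           ≡⟨ sym (m+n∸n≡m _ (2 ^ m)) ⟩
  ballot m 1 + emptyExcess m + 2 ^ m ∸ 2 ^ m           ≡⟨ cong (_∸ 2 ^ m) double ⟩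
  -- The division is exact: `ballot-catalan` exhibits the numerator as a multiple of the
  -- denominator.
  2 * ballot m 1 ∸ 2 ^ m                               ≡⟨ cong (_∸ 2 ^ m) (sym (m*n/n≡m (2 * ballot m 1) (suc m + 1))) ⟩
  2 * ballot m 1 * (suc m + 1) / (suc m + 1) ∸ 2 ^ m
    ≡⟨ cong (λ z → z / (suc m + 1) ∸ 2 ^ m) (trans (*-assoc 2 (ballot m 1) (suc m + 1)) (cong (2 *_) (ballot-catalan m))) ⟩
  (2 * ((2 * suc m) C suc m)) / (suc m + 1) ∸ 2 ^ m    ∎
  where
  open ≡-Reasoning
  double : ballot m 1 + emptyExcess m + 2 ^ m ≡ 2 * ballot m 1
  double = trans (+-assoc (ballot m 1) _ _)
           (cong (ballot m 1 +_) (trans (emptyExcess-ballot m) (sym (+-identityʳ _))))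

-- Forbidden patterns through the hole

data AllTriples {A : Set} (R : A → A → A → Set) : List A → Set where
  []  : AllTriples R []
  _∷_ : ∀ {x xs} → AllPairs (R x) xs → AllTriples R xs → AllTriples R (x ∷ xs)

data AllQuads {A : Set} (R : A → A → A → A → Set) : List A → Set where
  []  : AllQuads R []
  _∷_ : ∀ {x xs} → AllTriples (R x) xs → AllQuads R xs → AllQuads R (x ∷ xs)

module _ {A : Set} where

  allTriples? : {R : A → A → A → Set} → (∀ x y z → Dec (R x y z)) → ∀ xs → Dec (AllTriples R xs)
  allTriples? R? []       = yes []
  allTriples? R? (x ∷ xs) = map′ (λ (p , q) → p ∷ q) (λ { (p ∷ q) → p , q })
                                 (AllPairs.allPairs? (R? x) xs ×-dec allTriples? R? xs)

  allQuads? : {R : A → A → A → A → Set} → (∀ x y z t → Dec (R x y z t)) → ∀ xs → Dec (AllQuads R xs)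
  allQuads? R? []       = yes []
  allQuads? R? (x ∷ xs) = map′ (λ (p , q) → p ∷ q) (λ { (p ∷ q) → p , q })
                               (allTriples? (R? x) xs ×-dec allQuads? R? xs)

  AllPairs-fromAll : {P : A → Set} {R : A → A → Set} → (∀ {x y} → P x → P y → R x y) →
                     ∀ {xs} → All P xs → AllPairs R xs
  AllPairs-fromAll f []       = []
  AllPairs-fromAll f (p ∷ ps) = All.map (f p) ps ∷ AllPairs-fromAll f ps

  AllTriples-fromAll : {P : A → Set} {R : A → A → A → Set} → (∀ {x y z} → P x → P y → P z → R x y z) →
                       ∀ {xs} → All P xs → AllTriples R xs
  AllTriples-fromAll f []       = []
  AllTriples-fromAll f (p ∷ ps) = AllPairs-fromAll (f p) ps ∷ AllTriples-fromAll f ps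

  AllPairs-delete : {R : A → A → Set} → ∀ l {x r} → AllPairs R (l ++ x ∷ r) → AllPairs R (l ++ r)
  AllPairs-delete []      (_ ∷ ps) = ps
  AllPairs-delete (y ∷ l) (p ∷ ps) = Allₚ.++⁺ (Allₚ.++⁻ˡ l p) (All.tail (Allₚ.++⁻ʳ l p)) ∷ AllPairs-delete l ps

  AllPairs-before : {R : A → A → Set} → ∀ l {x r} → AllPairs R (l ++ x ∷ r) → All (λ y → R y x) l
  AllPairs-before []      _        = []
  AllPairs-before (y ∷ l) (p ∷ ps) = All.head (Allₚ.++⁻ʳ l p) ∷ AllPairs-before l ps

  AllPairs-dropˡ : {R : A → A → Set} → ∀ l {r} → AllPairs R (l ++ r) → AllPairs R r
  AllPairs-dropˡ []      ps       = ps
  AllPairs-dropˡ (_ ∷ l) (_ ∷ ps) = AllPairs-dropˡ l ps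

  AllPairs-insert : {R : A → A → Set} → ∀ l {x r} → AllPairs R (l ++ r) →
                    All (λ y → R y x) l → All (R x) r → AllPairs R (l ++ x ∷ r)
  AllPairs-insert []      ps       []       b = b ∷ ps
  AllPairs-insert (y ∷ l) (p ∷ ps) (a ∷ as) b =
    Allₚ.++⁺ (Allₚ.++⁻ˡ l p) (a ∷ Allₚ.++⁻ʳ l p) ∷ AllPairs-insert l ps as b

  AllTriples-delete : {R : A → A → A → Set} → ∀ l {x r} → AllTriples R (l ++ x ∷ r) → AllTriples R (l ++ r)
  AllTriples-delete []      (_ ∷ ps) = ps
  AllTriples-delete (y ∷ l) (p ∷ ps) = AllPairs-delete l p ∷ AllTriples-delete l ps

  AllTriples-around : {R : A → A → A → Set} → ∀ l {x r} → AllTriples R (l ++ x ∷ r) → All (λ y → All (R y x) r) l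
  AllTriples-around []      _        = []
  AllTriples-around (y ∷ l) (p ∷ ps) = AllPairs.head (AllPairs-dropˡ l p) ∷ AllTriples-around l ps

  AllTriples-after : {R : A → A → A → Set} → ∀ l {x r} → AllTriples R (l ++ x ∷ r) → AllPairs (R x) r
  AllTriples-after []      (p ∷ _)  = p
  AllTriples-after (y ∷ l) (_ ∷ ps) = AllTriples-after l ps

  AllTriples-insert : {R : A → A → A → Set} → ∀ l {x r} → AllTriples R (l ++ r) →
                      AllPairs (λ y z → R y z x) l → All (λ y → All (R y x) r) l → AllPairs (R x) r →
                      AllTriples R (l ++ x ∷ r)
  AllTriples-insert []      ps       _        _        b = b ∷ ps
  AllTriples-insert (y ∷ l) (p ∷ ps) (a ∷ as) (c ∷ cs) b =
    AllPairs-insert l p a c ∷ AllTriples-insert l ps as cs b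

  AllQuads-delete : {R : A → A → A → A → Set} → ∀ l {x r} → AllQuads R (l ++ x ∷ r) → AllQuads R (l ++ r)
  AllQuads-delete []      (_ ∷ ps) = ps
  AllQuads-delete (y ∷ l) (p ∷ ps) = AllTriples-delete l p ∷ AllQuads-delete l ps

Letter : Set
Letter = Maybe ℕ

-- A constructor is named after the letter of 2413 that the hole replaces; its inequalities order
-- the other three letters.
data Bad : Letter → Letter → Letter → Letter → Set where
  hole-2 : ∀ {x y z} → y < z → z < x → Bad nothing (just x) (just y) (just z)
  hole-4 : ∀ {x y z} → y < x → x < z → Bad (just x) nothing (just y) (just z)
  hole-1 : ∀ {x y z} → x < z → z < y → Bad (just x) (just y) nothing (just z)
  hole-3 : ∀ {x y z} → z < x → x < y → Bad (just x) (just y) (just z) nothing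

bad? : ∀ a b c d → Dec (Bad a b c d)
bad? nothing  (just x) (just y) (just z) =
  map′ (λ (p , q) → hole-2 p q) (λ { (hole-2 p q) → p , q }) (y <? z ×-dec z <? x)
bad? (just x) nothing  (just y) (just z) =
  map′ (λ (p , q) → hole-4 p q) (λ { (hole-4 p q) → p , q }) (y <? x ×-dec x <? z)
bad? (just x) (just y) nothing  (just z) =
  map′ (λ (p , q) → hole-1 p q) (λ { (hole-1 p q) → p , q }) (x <? z ×-dec z <? y)
bad? (just x) (just y) (just z) nothing  =
  map′ (λ (p , q) → hole-3 p q) (λ { (hole-3 p q) → p , q }) (z <? x ×-dec x <? y)
bad? (just _) (just _) (just _) (just _) = no λ ()
bad? nothing  nothing  _        _        = no λ ()
bad? nothing  (just _) nothing  _        = no λ ()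
bad? nothing  (just _) (just _) nothing  = no λ ()
bad? (just _) nothing  nothing  _        = no λ ()
bad? (just _) nothing  (just _) nothing  = no λ ()
bad? (just _) (just _) nothing  nothing  = no λ ()

NotBad : Letter → Letter → Letter → Letter → Set
NotBad a b c d = ¬ Bad a b c d

Valid : List Letter → Set
Valid = AllQuads NotBad

valid? : ∀ w → Dec (Valid w)
valid? = allQuads? (λ a b c d → ¬? (bad? a b c d))

-- Avoidance as order conditions on the two sides of the hole

word : List ℕ → List ℕ → List Letter
word A B = map just A ++ nothing ∷ map just B

-- With a single hole, each bad pattern fits in only one way: the fields exclude `hole-3`, `hole-2`,
-- `hole-4` and `hole-1` in this order, having 3, 0, 1 and 2 letters before the hole.
record Avoiding (A B : List ℕ) : Set where
  constructor avoiding
  field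
    left-231   : AllTriples (λ x y z → ¬ (z < x × x < y)) A
    right-312  : AllTriples (λ x y z → ¬ (y < z × z < x)) B
    left-right : All (λ x → AllPairs (λ y z → ¬ (y < x × x < z)) B) A
    lefts-right : AllPairs (λ x y → All (λ z → ¬ (x < z × z < y)) B) A

private
  map-All : ∀ {P : Letter → Set} → (∀ x → P (just x)) → ∀ xs → All P (map just xs)
  map-All f xs = Allₚ.map⁺ (All.universal f xs)

  map-AllPairs : ∀ {R : Letter → Letter → Set} → (∀ x y → R (just x) (just y)) → ∀ xs → AllPairs R (map just xs)
  map-AllPairs f []       = []
  map-AllPairs f (x ∷ xs) = map-All (f x) xs ∷ map-AllPairs f xs

  map-AllTriples : ∀ {R : Letter → Letter → Letter → Set} → (∀ x y z → R (just x) (just y) (just z)) →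
                   ∀ xs → AllTriples R (map just xs)
  map-AllTriples f []       = []
  map-AllTriples f (x ∷ xs) = map-AllPairs (f x) xs ∷ map-AllTriples f xs

  map-AllQuads : ∀ xs → AllQuads NotBad (map just xs)
  map-AllQuads []       = []
  map-AllQuads (x ∷ xs) = map-AllTriples (λ _ _ _ ()) xs ∷ map-AllQuads xs

AllTriples-map⁺ : ∀ {A B : Set} {R : B → B → B → Set} {f : A → B} {xs} →
                  AllTriples (λ x y z → R (f x) (f y) (f z)) xs → AllTriples R (map f xs)
AllTriples-map⁺ []       = []
AllTriples-map⁺ (p ∷ ps) = AllPairsₚ.map⁺ p ∷ AllTriples-map⁺ ps

AllTriples-map⁻ : ∀ {A B : Set} {R : B → B → B → Set} {f : A → B} {xs} →
                  AllTriples R (map f xs) → AllTriples (λ x y z → R (f x) (f y) (f z)) xs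
AllTriples-map⁻ {xs = []}    _        = []
AllTriples-map⁻ {xs = _ ∷ _} (p ∷ ps) = AllPairsₚ.map⁻ p ∷ AllTriples-map⁻ ps

AllTriples-⊆ : ∀ {A : Set} {R S : A → A → A → Set} → (∀ {x y z} → R x y z → S x y z) →
               ∀ {xs} → AllTriples R xs → AllTriples S xs
AllTriples-⊆ f []       = []
AllTriples-⊆ f (p ∷ ps) = AllPairs.map f p ∷ AllTriples-⊆ f ps

private
  pair⁻ : ∀ x y A {B} → AllPairs (NotBad (just x) (just y)) (word A B) →
          All (λ z → ¬ (z < x × x < y)) A × All (λ z → ¬ (x < z × z < y)) B
  pair⁻ x y []      (p ∷ _)  = [] , All.map (λ n (a , b) → n (hole-1 a b)) (Allₚ.map⁻ p)
  pair⁻ x y (z ∷ A) (p ∷ ps) with pair⁻ x y A ps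
  ... | a , b = (λ (u , v) → All.head (Allₚ.++⁻ʳ (map just A) p) (hole-3 u v)) ∷ a , b

  pair⁺ : ∀ x y A {B} → All (λ z → ¬ (z < x × x < y)) A → All (λ z → ¬ (x < z × z < y)) B →
          AllPairs (NotBad (just x) (just y)) (word A B)
  pair⁺ x y []      {B} _        b = Allₚ.map⁺ (All.map (λ { n (hole-1 u v) → n (u , v) }) b) ∷ map-AllPairs (λ _ _ ()) B
  pair⁺ x y (z ∷ A) {B} (a ∷ as) b =
    Allₚ.++⁺ (map-All (λ _ ()) A) ((λ { (hole-3 u v) → a (u , v) }) ∷ map-All (λ _ ()) B) ∷ pair⁺ x y A as b

  triple⁻ : ∀ x A {B} → AllTriples (NotBad (just x)) (word A B) →
            AllPairs (λ y z → ¬ (z < x × x < y)) A × All (λ y → All (λ z → ¬ (x < z × z < y)) B) A ×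
            AllPairs (λ y z → ¬ (y < x × x < z)) B
  triple⁻ x []      (p ∷ _)  = [] , [] , AllPairs.map (λ n (a , b) → n (hole-4 a b)) (AllPairsₚ.map⁻ p)
  triple⁻ x (y ∷ A) (p ∷ ps) with pair⁻ x y A p | triple⁻ x A ps
  ... | a , b | a′ , b′ , c = a ∷ a′ , b ∷ b′ , c

  triple⁺ : ∀ x A {B} → AllPairs (λ y z → ¬ (z < x × x < y)) A → All (λ y → All (λ z → ¬ (x < z × z < y)) B) A →
            AllPairs (λ y z → ¬ (y < x × x < z)) B → AllTriples (NotBad (just x)) (word A B)
  triple⁺ x []      {B} _        _        c =
    AllPairsₚ.map⁺ (AllPairs.map (λ { n (hole-4 u v) → n (u , v) }) c) ∷ map-AllTriples (λ _ _ _ ()) B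
  triple⁺ x (y ∷ A) (a ∷ as) (b ∷ bs) c = pair⁺ x y A a b ∷ triple⁺ x A as bs c

Valid⇒Avoiding : ∀ A {B} → Valid (word A B) → Avoiding A B
Valid⇒Avoiding []      (p ∷ _)  =
  avoiding [] (AllTriples-⊆ (λ n (a , b) → n (hole-2 a b)) (AllTriples-map⁻ p)) [] []
Valid⇒Avoiding (x ∷ A) (p ∷ ps) with triple⁻ x A p | Valid⇒Avoiding A ps
... | a , b , c | avoiding a′ d c′ b′ = avoiding (a ∷ a′) d (c ∷ c′) (b ∷ b′)

Avoiding⇒Valid : ∀ A {B} → Avoiding A B → Valid (word A B)
Avoiding⇒Valid []      {B} (avoiding _ d _ _) =
  AllTriples-map⁺ (AllTriples-⊆ (λ { n (hole-2 u v) → n (u , v) }) d) ∷ map-AllQuads B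
Avoiding⇒Valid (x ∷ A) (avoiding (a ∷ a′) d (c ∷ c′) (b ∷ b′)) =
  triple⁺ x A a b c ∷ Avoiding⇒Valid A (avoiding a′ d c′ b′)

All-insert : ∀ {A : Set} {P : A → Set} l {x r} → All P (l ++ r) → P x → All P (l ++ x ∷ r)
All-insert l p q = Allₚ.++⁺ (Allₚ.++⁻ˡ l p) (q ∷ Allₚ.++⁻ʳ l p)

AllPairs-map-All : ∀ {A : Set} {P : A → Set} {R S : A → A → Set} → (∀ {x y} → P x → P y → R x y → S x y) →
                   ∀ {xs} → All P xs → AllPairs R xs → AllPairs S xs
AllPairs-map-All f []       []       = []
AllPairs-map-All f (p ∷ ps) (q ∷ qs) = All.zipWith (λ (a , b) → f p a b) (ps , q) ∷ AllPairs-map-All f ps qs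

module _ {M : ℕ} where

  -- In `A`, the maximum can be the 3 of a 231 or the 4 of `hole-1`. Excluding the first role orders
  -- `l` against `r`, and excluding the second orders `l` against `B`; no other role suits a
  -- maximum, which gives the converse `insertˡ⁺`.
  insertˡ⁻ : ∀ l {r B} → All (_< M) l → All (_< M) B → Avoiding (l ++ M ∷ r) B →
             All (λ x → All (x ≤_) r) l × All (λ x → All (_≤ x) B) l
  insertˡ⁻ l l<M B<M (avoiding a _ _ d) =
      All.zipWith (λ (x<M , p) → All.map (λ n → ≮⇒≥ (λ z<x → n (z<x , x<M))) p) (l<M , AllTriples-around l a)
    , All.map (λ q → All.zipWith (λ (z<M , n) → ≮⇒≥ (λ x<z → n (x<z , z<M))) (B<M , q)) (AllPairs-before l d)

  insertˡ⁺ : ∀ l {r B} → All (_< M) l → All (_< M) r → All (_< M) B → Avoiding (l ++ r) B →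
             All (λ x → All (x ≤_) r) l → All (λ x → All (_≤ x) B) l → Avoiding (l ++ M ∷ r) B
  insertˡ⁺ l l<M r<M B<M (avoiding a b c d) l≤r B≤l = avoiding
    (AllTriples-insert l a
      (AllPairs-fromAll (λ y<M _ (M<y , _) → <-asym y<M M<y) l<M)
      (All.map (All.map (λ x≤z (z<x , _) → <⇒≱ z<x x≤z)) l≤r)
      (AllPairs-fromAll (λ y<M _ (_ , M<y) → <-asym y<M M<y) r<M))
    b
    (All-insert l c (AllPairs-fromAll (λ _ z<M (_ , M<z) → <-asym z<M M<z) B<M))
    (AllPairs-insert l d
      (All.map (All.map (λ z≤x (x<z , _) → <⇒≱ x<z z≤x)) B≤l)
      (All.universal (λ _ → All.map (λ z<M (M<z , _) → <-asym z<M M<z) B<M) _))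

  -- In `B`, the maximum can be the 3 of a 312, which forces `r` to decrease, or the 3 of `hole-4`,
  -- where the 4 is the hole; the latter puts `l` above `A`. `insertʳ⁺` is the converse.
  insertʳ⁻ : ∀ {A} l {r} → All (_< M) A → All (_< M) r → Avoiding A (l ++ M ∷ r) →
             AllPairs _≥_ r × All (λ b → All (_≤ b) A) l
  insertʳ⁻ l A<M r<M (avoiding _ b c _) =
      AllPairs-map-All (λ _ z<M n → ≮⇒≥ (λ y<z → n (y<z , z<M))) r<M (AllTriples-after l b)
    , Allₚ.All-swap (All.zipWith (λ (a<M , p) → All.map (λ n → ≮⇒≥ (λ b<a → n (b<a , a<M))) (AllPairs-before l p)) (A<M , c))

  insertʳ⁺ : ∀ {A} l {r} → All (_< M) A → All (_< M) l → All (_< M) r → Avoiding A (l ++ r) →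
             AllPairs _≥_ r → All (λ b → All (_≤ b) A) l → Avoiding A (l ++ M ∷ r)
  insertʳ⁺ l A<M l<M r<M (avoiding a b c d) r≥ A≤l = avoiding
    a
    (AllTriples-insert l b
      (AllPairs-fromAll (λ y<M _ (_ , M<y) → <-asym y<M M<y) l<M)
      (All.universal (λ _ → All.map (λ z<M (M<z , _) → <-asym z<M M<z) r<M) _)
      (AllPairs.map (λ z≤y (y<z , _) → <⇒≱ y<z z≤y) r≥))
    (All.zipWith (λ ((a<M , A≤) , p) → AllPairs-insert l p
        (All.map (λ a≤b (b<a , _) → <⇒≱ b<a a≤b) A≤)
        (All.universal (λ _ (M<a , _) → <-asym a<M M<a) _))
      (All.zip (A<M , Allₚ.All-swap A≤l) , c))
    (AllPairs-map-All (λ _ y<M p → All-insert l p (λ (_ , M<y) → <-asym y<M M<y)) A<M d)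

-- Insertion of a new maximum

inserts : {X : Set} → X → List X → List (List X)
inserts x []      = [ x ∷ [] ]
inserts x (y ∷ w) = (x ∷ y ∷ w) ∷ map (y ∷_) (inserts x w)

children : ℕ → List Letter → List (List Letter)
children m w = filter valid? (inserts (just m) w)

descend : ℕ → ℕ → List Letter → ℕ
descend zero    m w = 1
descend (suc k) m w = sum (map (descend k (suc m)) (children m w))

sum-filter : {X : Set} {P : X → Set} (P? : Decidable P) (f : X → ℕ) → ∀ xs →
             sum (map f (filter P? xs)) ≡ sum (map (λ x → if does (P? x) then f x else 0) xs)
sum-filter P? f []       = refl
sum-filter P? f (x ∷ xs) with does (P? x)
... | true  = cong (f x +_) (sum-filter P? f xs)
... | false = sum-filter P? f xs

sumCuts : (List ℕ → List ℕ → ℕ) → List ℕ → ℕ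
sumCuts h []      = h [] []
sumCuts h (y ∷ w) = h [] (y ∷ w) + sumCuts (λ l → h (y ∷ l)) w

sum-inserts-just : ∀ (g : List Letter → ℕ) m B →
                   sum (map g (inserts (just m) (map just B))) ≡ sumCuts (λ l r → g (map just (l ++ m ∷ r))) B
sum-inserts-just g m []      = +-identityʳ _
sum-inserts-just g m (b ∷ B) = cong (g (map just (m ∷ b ∷ B)) +_)
  (trans (cong sum (sym (map-∘ (inserts (just m) (map just B))))) (sum-inserts-just (λ w → g (just b ∷ w)) m B))

-- The gaps just before and just after the hole are different, so each side contributes all its
-- cuts, both ends included.
sum-inserts : ∀ (g : List Letter → ℕ) m A B →
              sum (map g (inserts (just m) (word A B))) ≡
              sumCuts (λ l r → g (word (l ++ m ∷ r) B)) A + sumCuts (λ l r → g (word A (l ++ m ∷ r))) B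
sum-inserts g m []      B = cong (g (word (m ∷ []) B) +_)
  (trans (cong sum (sym (map-∘ (inserts (just m) (map just B))))) (sum-inserts-just (λ w → g (nothing ∷ w)) m B))
sum-inserts g m (a ∷ A) B =
  trans (cong (g (word (m ∷ a ∷ A) B) +_)
    (trans (cong sum (sym (map-∘ (inserts (just m) (word A B))))) (sum-inserts (λ w → g (just a ∷ w)) m A B)))
  (sym (+-assoc (g (word (m ∷ a ∷ A) B)) _ _))

sumCuts-zero : ∀ h w → (∀ l r → l ++ r ≡ w → h l r ≡ 0) → sumCuts h w ≡ 0
sumCuts-zero h []      z = z [] [] refl
sumCuts-zero h (y ∷ w) z rewrite z [] (y ∷ w) refl = sumCuts-zero _ w (λ l r e → z (y ∷ l) r (cong (y ∷_) e))

sumCuts-head : ∀ h w → (∀ x l r → x ∷ l ++ r ≡ w → h (x ∷ l) r ≡ 0) → sumCuts h w ≡ h [] w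
sumCuts-head h []      z = refl
sumCuts-head h (y ∷ w) z =
  trans (cong (h [] (y ∷ w) +_) (sumCuts-zero _ w (λ l r e → z y l r (cong (y ∷_) e)))) (+-identityʳ _)

sumCuts-skipˡ : ∀ h u v → (∀ l y r → l ++ y ∷ r ≡ u → h l (y ∷ r ++ v) ≡ 0) →
                sumCuts h (u ++ v) ≡ sumCuts (λ l → h (u ++ l)) v
sumCuts-skipˡ h []      v z = refl
sumCuts-skipˡ h (y ∷ u) v z rewrite z [] y u refl =
  sumCuts-skipˡ (λ l → h (y ∷ l)) u v (λ l x r e → z (y ∷ l) x r (cong (y ∷_) e))

sumCuts-skipʳ : ∀ h u v → (∀ y l r → y ∷ l ++ r ≡ v → h (u ++ y ∷ l) r ≡ 0) →
                sumCuts h (u ++ v) ≡ sumCuts (λ l r → h l (r ++ v)) u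
sumCuts-skipʳ h []      v z = sumCuts-head h v z
sumCuts-skipʳ h (x ∷ u) v z = cong (h [] (x ∷ u ++ v) +_) (sumCuts-skipʳ (λ l → h (x ∷ l)) u v z)

sumCuts-lengths : ∀ h (φ : ℕ → ℕ) w → (∀ l r → l ++ r ≡ w → h l r ≡ φ (length r)) → sumCuts h w ≡ sumTo φ (length w)
sumCuts-lengths h φ []      e = e [] [] refl
sumCuts-lengths h φ (y ∷ w) e =
  cong₂ _+_ (e [] (y ∷ w) refl) (sumCuts-lengths _ φ w (λ l r p → e (y ∷ l) r (cong (y ∷_) p)))

-- The invariant that ties a label to the shape of a word

Decreasing : Bool → List ℕ → Set
Decreasing true  B = AllPairs _≥_ B
Decreasing false B = ¬ AllPairs _≥_ B

Mixed : List ℕ → List ℕ → Set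
Mixed A B = Any (λ a → Any (a <_) B) A

-- Every cut past the head of `R` has this head on its left, so one letter of `A` above the head
-- excludes them all.
data Under (A : List ℕ) : List ℕ → Set where
  []  : Under A []
  _∷_ : ∀ {y} → Any (y <_) A → ∀ R → Under A (y ∷ R)

-- The maximum may be inserted into B exactly at the cuts of D.
data RightTail (A : List ℕ) : Bool → ℕ → List ℕ → Set where
  whole : ∀ D R → AllPairs _≥_ (D ++ R) → All (λ b → All (_≤ b) A) D → Under A R →
          RightTail A true (length D) (D ++ R)
  after-ascent : ∀ L {x d} D R → x < d → AllPairs _≥_ (d ∷ D ++ R) →
                 All (λ b → All (_≤ b) A) ((L ++ [ x ]) ++ d ∷ D) → Under A R →
                 RightTail A false (suc (length D)) ((L ++ [ x ]) ++ d ∷ D ++ R)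

-- The maximum may be inserted into A exactly between the blocks.
data Blocks : ℕ → List ℕ → Set where
  []    : Blocks 0 []
  block : ∀ {c p A} K → All (_< c) K → All (λ x → All (x ≤_) A) (c ∷ K) → Blocks p A →
          Blocks (suc p) ((c ∷ K) ++ A)

Dominated : List ℕ → List ℕ → Set
Dominated A B = Any (λ a → All (_< a) B) A

-- In the last two shapes, `Dominated` forces every insertion into `B` to the front; in `leftAbove`
-- it also records that `A` is nonempty.
Shape : State → List ℕ → List ℕ → Set
Shape (leftEmpty f t) A B = A ≡ [] × RightTail A f t B
Shape (rightTop f t)  A B = Mixed A B × RightTail A f t B
Shape (leftTop f)     A B = Mixed A B × Dominated A B × Decreasing f B
Shape (leftAbove f p) A B = Blocks p A × All (λ a → All (_< a) B) A × Dominated A B × Decreasing f B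

record Inv (m : ℕ) (s : State) (A B : List ℕ) : Set where
  constructor inv
  field
    left<    : All (_< m) A
    right<   : All (_< m) B
    avoids   : Avoiding A B
    shape    : Shape s A B

split-snoc : ∀ {x : ℕ} L l y r → l ++ y ∷ r ≡ L ++ [ x ] → ∃[ u ] y ∷ r ≡ u ++ [ x ]
split-snoc L       []      y r e  = L , e
split-snoc []      (z ∷ []) y r ()
split-snoc []      (z ∷ _ ∷ l) y r ()
split-snoc (w ∷ L) (z ∷ l) y r e = split-snoc L l y r (cong (λ { [] → [] ; (_ ∷ xs) → xs }) e)

cons-snoc : ∀ (y : ℕ) l → ∃[ L ] ∃[ x ] y ∷ l ≡ L ++ [ x ]
cons-snoc y []      = [] , y , refl
cons-snoc y (z ∷ l) with cons-snoc z l
... | L , x , e = y ∷ L , x , cong (y ∷_) e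

-- Used with `c` the new maximum inserted after `q` blocks: it fuses with everything to its right
-- into one block, so `suc q` blocks result.
Blocks-snoc : ∀ {q P c} K → Blocks q P → All (_< c) K → All (λ x → All (x ≤_) (c ∷ K)) P → Blocks (suc q) (P ++ c ∷ K)
Blocks-snoc K [] K<c _ = subst (Blocks 1) (++-identityʳ _) (block K K<c (All.universal (λ _ → []) _) [])
Blocks-snoc {P = P} {c} K (block {c′} {p} {A} K′ K′<c′ ≤A bs) K<c P≤ =
  subst (Blocks _) (sym (++-assoc (c′ ∷ K′) A (c ∷ K)))
    (block K′ K′<c′ (All.zipWith (λ (a , b) → Allₚ.++⁺ a b) (≤A , Allₚ.++⁻ˡ (c′ ∷ K′) P≤))
           (Blocks-snoc K bs K<c (Allₚ.++⁻ʳ (c′ ∷ K′) P≤)))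

-- The induction walks through the blocks: `P` holds the `q` blocks already passed and `A` the `p`
-- blocks still ahead.
Blocks-sum : ∀ (h : List ℕ → List ℕ → ℕ) (φ : ℕ → ℕ) {q} P {p} A → Blocks q P → Blocks p A → All (λ x → All (x ≤_) A) P →
             (∀ {i} l r → l ++ r ≡ P ++ A → Blocks i l → All (λ x → All (x ≤_) r) l → h l r ≡ φ i) →
             (∀ l r → l ++ r ≡ P ++ A → ¬ All (λ x → All (x ≤_) r) l → h l r ≡ 0) →
             sumCuts (λ l → h (P ++ l)) A ≡ sumTo (λ i → φ (i + q)) p
Blocks-sum h φ P [] bP [] _ good bad = trans (cong (λ z → h z []) (++-identityʳ P)) (good P [] refl bP (All.universal (λ _ → []) _))
Blocks-sum h φ {q} P {suc p} .((c ∷ K) ++ A) bP (block {c} {_} {A} K K<c ≤A bA) P≤ good bad =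
  trans (cong₂ _+_ first (trans skip rest)) (sym (sumTo-shift (λ i → φ (i + q)) p))
  where
  first : h (P ++ []) (c ∷ K ++ A) ≡ φ q
  first = trans (cong (λ z → h z (c ∷ K ++ A)) (++-identityʳ P)) (good P (c ∷ K ++ A) refl bP P≤)
  skip : sumCuts (λ l → h (P ++ c ∷ l)) (K ++ A) ≡ sumCuts (λ l → h (P ++ c ∷ K ++ l)) A
  -- A cut inside a block separates `c` from a smaller letter behind it.
  skip = sumCuts-skipˡ (λ l → h (P ++ c ∷ l)) K A λ l y r e → bad (P ++ c ∷ l) (y ∷ r ++ A)
    (trans (++-assoc P (c ∷ l) (y ∷ r ++ A)) (cong (λ z → P ++ c ∷ z) (trans (sym (++-assoc l (y ∷ r) A)) (cong (_++ A) e))))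
    (λ all → <⇒≱ (All.head (Allₚ.++⁻ʳ l (subst (All (_< c)) (sym e) K<c)))
                 (All.head (All.head (Allₚ.++⁻ʳ P all))))
  assoc : ∀ l → (P ++ c ∷ K) ++ l ≡ P ++ c ∷ K ++ l
  assoc = ++-assoc P (c ∷ K)
  rest : sumCuts (λ l → h (P ++ c ∷ K ++ l)) A ≡ sumTo (λ i → φ (suc i + q)) p
  rest = trans (sumCuts-cong A (λ l r → cong (λ z → h z r) (sym (assoc l))))
         (trans (Blocks-sum h φ (P ++ c ∷ K) A (Blocks-snoc K bP K<c (All.map (Allₚ.++⁻ˡ (c ∷ K)) P≤)) bA
                  (Allₚ.++⁺ (All.map (Allₚ.++⁻ʳ (c ∷ K)) P≤) ≤A)
                  (λ l r e → good l r (trans e (assoc A))) (λ l r e → bad l r (trans e (assoc A))))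
                (sumTo-cong (λ i → cong φ (+-suc i q)) p))
    where
    sumCuts-cong : ∀ {h h′} w → (∀ l r → h l r ≡ h′ l r) → sumCuts h w ≡ sumCuts h′ w
    sumCuts-cong []      e = e [] []
    sumCuts-cong (y ∷ w) e = cong₂ _+_ (e [] (y ∷ w)) (sumCuts-cong w (λ l r → e (y ∷ l) r))

module _ {M : ℕ} {A : List ℕ} (A<M : All (_< M) A) where

  private
    A≤M : All (_≤ M) A
    A≤M = All.map <⇒≤ A<M

  -- The last letter of the nonempty prefix `y ∷ P` is the `x` of the new ascent, and `M` is its
  -- top.
  RightTail-ascent : ∀ y P D R → All (_< M) (y ∷ P) → All (_< M) (D ++ R) → AllPairs _≥_ (D ++ R) →
                     All (λ b → All (_≤ b) A) (y ∷ P) → All (λ b → All (_≤ b) A) D → Under A R →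
                     RightTail A false (suc (length D)) ((y ∷ P) ++ M ∷ D ++ R)
  RightTail-ascent y P D R P<M DR<M DR≥ A≤P A≤D A∤R with cons-snoc y P
  ... | L , x , e =
    subst (λ Q → RightTail A false (suc (length D)) (Q ++ M ∷ D ++ R)) (sym e)
      (after-ascent L D R (All.head (Allₚ.++⁻ʳ L (subst (All (_< M)) e P<M))) (All.map <⇒≤ DR<M ∷ DR≥)
        (Allₚ.++⁺ (subst (All _) e A≤P) (A≤M ∷ A≤D)) A∤R)

  RightTail-sum : ∀ (h : List ℕ → List ℕ → ℕ) (φ : Bool → ℕ → ℕ) {f t B} → RightTail A f t B →
                  All (_< M) B → Avoiding A B →
                  (∀ {f t} l r → l ++ r ≡ B → RightTail A f t (l ++ M ∷ r) → Avoiding A (l ++ M ∷ r) → h l r ≡ φ f t) →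
                  (∀ l r → l ++ r ≡ B → ¬ Avoiding A (l ++ M ∷ r) → h l r ≡ 0) →
                  sumCuts h B ≡ tailSum φ f t
  RightTail-sum h φ {B = B} tail B<M av good bad = go tail refl
    where
    bounds : ∀ l {r} → l ++ r ≡ B → All (_< M) l × All (_< M) r
    bounds l refl = Allₚ.++⁻ˡ l B<M , Allₚ.++⁻ʳ l B<M

    under : ∀ u {R} → u ++ R ≡ B → Under A R → ∀ y l r → y ∷ l ++ r ≡ R → h (u ++ y ∷ l) r ≡ 0
    under u e (y<A ∷ _) y l r refl = bad (u ++ y ∷ l) r e′ λ av′ →
      let _ , A≤ = insertʳ⁻ (u ++ y ∷ l) A<M (proj₂ (bounds (u ++ y ∷ l) e′)) av′
      in Allₚ.All¬⇒¬Any (All.map ≤⇒≯ (All.head (Allₚ.++⁻ʳ u A≤))) y<A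
      where e′ = trans (++-assoc u (y ∷ l) r) e

    avoids : ∀ l {r} → l ++ r ≡ B → AllPairs _≥_ r → All (λ b → All (_≤ b) A) l → Avoiding A (l ++ M ∷ r)
    avoids l e r≥ A≤l = insertʳ⁺ l A<M (proj₁ (bounds l e)) (proj₂ (bounds l e)) (subst (Avoiding A) (sym e) av) r≥ A≤l

    ascent : ∀ y P D R → (y ∷ P) ++ D ++ R ≡ B → AllPairs _≥_ (D ++ R) →
             All (λ b → All (_≤ b) A) ((y ∷ P) ++ D) → Under A R → h (y ∷ P) (D ++ R) ≡ φ false (suc (length D))
    ascent y P D R e DR≥ A≤ A∤R =
      good (y ∷ P) (D ++ R) e
        (RightTail-ascent y P D R (proj₁ (bounds (y ∷ P) e)) (proj₂ (bounds (y ∷ P) e)) DR≥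
          (Allₚ.++⁻ˡ (y ∷ P) A≤) (Allₚ.++⁻ʳ (y ∷ P) A≤) A∤R)
        (avoids (y ∷ P) e DR≥ (Allₚ.++⁻ˡ (y ∷ P) A≤))

    front : ∀ D R → D ++ R ≡ B → AllPairs _≥_ (D ++ R) → All (λ b → All (_≤ b) A) D → Under A R →
            h [] (D ++ R) ≡ φ true (suc (length D))
    front D R e DR≥ A≤D A∤R =
      good [] (D ++ R) e (whole (M ∷ D) R (All.map <⇒≤ (subst (All (_< M)) (sym e) B<M) ∷ DR≥) (A≤M ∷ A≤D) A∤R)
           (avoids [] e DR≥ [])

    go : ∀ {f t B′} → RightTail A f t B′ → B′ ≡ B → sumCuts h B′ ≡ tailSum φ f t
    go (whole [] R R≥ A≤ A∤R) e =
      trans (sumCuts-head h R (under [] e A∤R)) (front [] R e R≥ A≤ A∤R)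
    go (whole (d ∷ D) R DR≥ A≤ A∤R) e =
      trans (sumCuts-skipʳ h (d ∷ D) R (under (d ∷ D) e A∤R))
      (cong₂ _+_ (front (d ∷ D) R e DR≥ A≤ A∤R)
        (sumCuts-lengths _ (λ s → φ false (suc s)) D λ l r p →
          ascent d l r R (trans (trans (sym (++-assoc (d ∷ l) r R)) (cong (λ z → d ∷ z ++ R) p)) e)
            (AllPairs-dropˡ (d ∷ l) (subst (AllPairs _≥_) (trans (cong (λ z → d ∷ z ++ R) (sym p)) (++-assoc (d ∷ l) r R)) DR≥))
            (subst (All _) (cong (d ∷_) (sym p)) A≤) A∤R))
    go (after-ascent L {x} {d} D R x<d dDR≥ A≤ A∤R) e with cons-snoc′ L x
      where
      cons-snoc′ : ∀ L x → ∃[ y ] ∃[ P ] L ++ [ x ] ≡ y ∷ P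
      cons-snoc′ []      x = x , [] , refl
      cons-snoc′ (y ∷ L) x = y , L ++ [ x ] , refl
    ... | y₀ , P , e₀ =
      trans (sumCuts-skipˡ h (L ++ [ x ]) (d ∷ D ++ R) skip)
      (trans (sumCuts-skipʳ (λ l → h ((L ++ [ x ]) ++ l)) (d ∷ D) R
               (λ y l r p → trans (cong (λ z → h z r) (sym (++-assoc (L ++ [ x ]) (d ∷ D) (y ∷ l))))
                                  (under ((L ++ [ x ]) ++ d ∷ D) (trans (++-assoc (L ++ [ x ]) (d ∷ D) R) e) A∤R y l r p)))
        (sumCuts-lengths _ (λ s → φ false (suc s)) (d ∷ D) inside))
      where
      -- A cut to the left of `x` keeps the ascent `x < d` on its right, where the letters would
      -- have to decrease.
      skip : ∀ l y r → l ++ y ∷ r ≡ L ++ [ x ] → h l (y ∷ r ++ d ∷ D ++ R) ≡ 0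
      skip l y r p = bad l _ e′ λ av′ → contra (proj₁ (insertʳ⁻ l A<M (proj₂ (bounds l e′)) av′))
        where
        e′ = trans (trans (sym (++-assoc l (y ∷ r) _)) (cong (_++ d ∷ D ++ R) p)) e
        contra : ¬ AllPairs _≥_ (y ∷ r ++ d ∷ D ++ R)
        contra r≥ with split-snoc L l y r p
        ... | u , q = <⇒≱ x<d (All.head (AllPairs.head (AllPairs-dropˡ u
          (subst (AllPairs _≥_) (trans (cong (_++ d ∷ D ++ R) q) (++-assoc u [ x ] _)) r≥))))
      inside : ∀ l r → l ++ r ≡ d ∷ D → h ((L ++ [ x ]) ++ l) (r ++ R) ≡ φ false (suc (length r))
      inside l r p = trans (cong (λ z → h (z ++ l) (r ++ R)) e₀)
        (ascent y₀ (P ++ l) r R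
          (trans (cong (λ z → (z ++ l) ++ r ++ R) (sym e₀))
            (trans (trans (++-assoc (L ++ [ x ]) l (r ++ R)) (cong ((L ++ [ x ]) ++_) (trans (sym (++-assoc l r R)) (cong (_++ R) p)))) e))
          (AllPairs-dropˡ l (subst (AllPairs _≥_) (trans (cong (_++ R) (sym p)) (++-assoc l r R)) dDR≥))
          (subst (All _) (trans (cong ((L ++ [ x ]) ++_) (sym p)) (trans (sym (++-assoc (L ++ [ x ]) l r)) (cong (λ z → (z ++ l) ++ r) e₀))) A≤)
          A∤R)

RightTail⇒Decreasing : ∀ {A f t B} → RightTail A f t B → Decreasing f B
RightTail⇒Decreasing (whole D R DR≥ _ _)                      = DR≥
RightTail⇒Decreasing (after-ascent L {x} D R x<d dDR≥ _ _) B≥ =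
  <⇒≱ x<d (All.head (AllPairs.head (AllPairs-dropˡ L (subst (AllPairs _≥_) (++-assoc L (x ∷ []) _) B≥))))

module _ {m : ℕ} {A B : List ℕ} (A<m : All (_< m) A) (B<m : All (_< m) B) where

  -- A letter `x` left of the inserted maximum would have to be at least every letter of `B` and at
  -- most every letter of `r`. The letters of `l` are also bounded below by `B`, so all of `A` would
  -- lie above `B`.
  Mixed⇒¬left : Mixed A B → ∀ x l r → x ∷ l ++ r ≡ A → ¬ Avoiding ((x ∷ l) ++ m ∷ r) B
  Mixed⇒¬left mix x l r refl av with insertˡ⁻ (x ∷ l) (Allₚ.++⁻ˡ (x ∷ l) A<m) B<m av
  ... | l≤r , B≤l = Allₚ.All¬⇒¬Any (All.map (λ B≤a → Allₚ.All¬⇒¬Any (All.map ≤⇒≯ B≤a)) B≤A) mix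
    where
    B≤A : All (λ a → All (_≤ a) B) (x ∷ l ++ r)
    B≤A = Allₚ.++⁺ B≤l (All.map (λ x≤a → All.map (λ b≤x → ≤-trans b≤x x≤a) (All.head B≤l)) (All.head l≤r))

  -- Left of the inserted maximum, `y` would have to be at least every letter of `A`, yet the
  -- dominating letter exceeds it.
  Dominated⇒¬right : Dominated A B → ∀ y l r → y ∷ l ++ r ≡ B → ¬ Avoiding A ((y ∷ l) ++ m ∷ r)
  Dominated⇒¬right dom y l r refl av with insertʳ⁻ (y ∷ l) A<m (Allₚ.++⁻ʳ (y ∷ l) B<m) av
  ... | _ , A≤y ∷ _ = Allₚ.All¬⇒¬Any (All.map (λ a≤y B<a → <⇒≱ (All.head B<a) a≤y) A≤y) dom

  Dominated⇒Mixed : Dominated A B → Mixed A (m ∷ B)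
  Dominated⇒Mixed = go A<m
    where
    go : ∀ {A} → All (_< m) A → Any (λ a → All (_< a) B) A → Mixed A (m ∷ B)
    go (a<m ∷ _) (here _)  = here (here a<m)
    go (_ ∷ A<m) (there d) = there (go A<m d)

Dominated⇒Under : ∀ {A} B → Dominated A B → Under A B
Dominated⇒Under []      _   = []
Dominated⇒Under (_ ∷ R) dom = Any.map All.head dom ∷ R

descend≡descendants : ∀ k {m s A B} → Inv m s A B → descend k m (word A B) ≡ descendants k s
descend≡descendants zero    _ = refl
descend≡descendants (suc k) {m} {s} {A} {B} (inv A<m B<m av shape) =
  trans (sum-filter valid? (descend k (suc m)) (inserts _ (word A B)))
  (trans (sum-inserts weight m A B) (by-shape s shape))
  where
  -- The filter moves into the summand: an inadmissible cut counts 0, so the sums can run over all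
  -- cuts.
  weight : List Letter → ℕ
  weight w = if does (valid? w) then descend k (suc m) w else 0

  weight-good : ∀ {s} A′ B′ → Inv (suc m) s A′ B′ → weight (word A′ B′) ≡ descendants k s
  weight-good A′ B′ i rewrite dec-true (valid? (word A′ B′)) (Avoiding⇒Valid A′ (Inv.avoids i)) =
    descend≡descendants k i

  weight-bad : ∀ A′ B′ → ¬ Avoiding A′ B′ → weight (word A′ B′) ≡ 0
  weight-bad A′ B′ ¬av rewrite dec-false (valid? (word A′ B′)) (λ v → ¬av (Valid⇒Avoiding A′ v)) = refl

  leftSum rightSum : ℕ
  leftSum  = sumCuts (λ l r → weight (word (l ++ m ∷ r) B)) A
  rightSum = sumCuts (λ l r → weight (word A (l ++ m ∷ r))) B

  raise : ∀ {xs} → All (_< m) xs → All (_< suc m) xs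
  raise = All.map m<n⇒m<1+n

  raise-insert : ∀ {xs} l {r} → l ++ r ≡ xs → All (_< m) xs → All (_< suc m) (l ++ m ∷ r)
  raise-insert l refl p = All-insert l (raise p) ≤-refl

  A≤m : All (_≤ m) A
  A≤m = All.map <⇒≤ A<m

  left-mixed : ∀ f → Mixed A B → Decreasing f B → leftSum ≡ descendants k (leftTop f)
  left-mixed f mix dec =
    trans (sumCuts-head _ A (λ x l r e → weight-bad ((x ∷ l) ++ m ∷ r) B (Mixed⇒¬left A<m B<m mix x l r e)))
          (weight-good (m ∷ A) B (inv (≤-refl ∷ raise A<m) (raise B<m) (insertˡ⁺ [] [] A<m B<m av [] [])
            (there mix , here B<m , dec)))

  right-dominated : ∀ f → Dominated A B → Decreasing f B →
                    rightSum ≡ (if f then descendants k (rightTop true 1) else 0)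
  right-dominated f dom dec =
    trans (sumCuts-head _ B (λ y l r e → weight-bad A ((y ∷ l) ++ m ∷ r) (Dominated⇒¬right A<m B<m dom y l r e)))
          (front f dec)
    where
    front : ∀ f → Decreasing f B → weight (word A (m ∷ B)) ≡ (if f then descendants k (rightTop true 1) else 0)
    -- The run consists of `m` alone, because the dominating letter of `A` exceeds the head of `B`;
    -- hence the label `rightTop true 1`.
    front true  B≥ = weight-good A (m ∷ B) (inv (raise A<m) (≤-refl ∷ raise B<m) (insertʳ⁺ [] A<m [] B<m av B≥ [])
      (Dominated⇒Mixed A<m B<m dom
      , whole (m ∷ []) B (All.map <⇒≤ B<m ∷ B≥) (A≤m ∷ []) (Dominated⇒Under B dom)))
    front false ¬B≥ = weight-bad A (m ∷ B) (λ av′ → ¬B≥ (proj₁ (insertʳ⁻ [] A<m B<m av′)))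

  right-tail : ∀ (state : Bool → ℕ → State) →
               (∀ {f t} l r → l ++ r ≡ B → RightTail A f t (l ++ m ∷ r) → Shape (state f t) A (l ++ m ∷ r)) →
               ∀ {f t} → RightTail A f t B → rightSum ≡ tailSum (λ f′ t′ → descendants k (state f′ t′)) f t
  right-tail state mk tail = RightTail-sum A<m _ _ tail B<m av
    (λ l r e tail′ av′ → weight-good A (l ++ m ∷ r) (inv (raise A<m) (raise-insert l e B<m) av′ (mk l r e tail′)))
    (λ l r _ ¬av → weight-bad A (l ++ m ∷ r) ¬av)

  by-shape : ∀ s → Shape s A B → leftSum + rightSum ≡ descendants (suc k) s
  by-shape (leftEmpty f t) (refl , tail) = cong₂ _+_
    (weight-good (m ∷ []) B (inv (≤-refl ∷ []) (raise B<m) (insertˡ⁺ [] [] [] B<m av [] [])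
      (block [] [] ([] ∷ []) [] , B<m ∷ [] , here B<m , RightTail⇒Decreasing tail)))
    (right-tail leftEmpty (λ _ _ _ tail′ → refl , tail′) tail)
  by-shape (rightTop f t) (mix , tail) = cong₂ _+_
    (left-mixed f mix (RightTail⇒Decreasing tail))
    (right-tail rightTop (λ { l r refl tail′ → Any.map (Any-insert l) mix , tail′ }) tail)
    where
    Any-insert : ∀ l {r} {P : ℕ → Set} → Any P (l ++ r) → Any P (l ++ m ∷ r)
    Any-insert l p with Anyₚ.++⁻ l p
    ... | inj₁ q = Anyₚ.++⁺ˡ q
    ... | inj₂ q = Anyₚ.++⁺ʳ l (there q)
  by-shape (leftTop f) (mix , dom , dec) = cong₂ _+_ (left-mixed f mix dec) (right-dominated f dom dec)
  by-shape (leftAbove f p) (bs , B<A , dom , dec) = cong₂ _+_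
    (trans (Blocks-sum (λ l r → weight (word (l ++ m ∷ r) B)) (λ q → descendants k (leftAbove f (suc q))) [] A [] bs [] good bad)
           (sumTo-cong (λ i → cong (λ z → descendants k (leftAbove f (suc z))) (+-identityʳ i)) p))
    (right-dominated f dom dec)
    where
    good : ∀ {i} l r → l ++ r ≡ A → Blocks i l → All (λ x → All (x ≤_) r) l →
           weight (word (l ++ m ∷ r) B) ≡ descendants k (leftAbove f (suc i))
    good l r refl bl l≤r = weight-good (l ++ m ∷ r) B (inv (raise-insert l refl A<m) (raise B<m)
      (insertˡ⁺ l l<m r<m B<m av l≤r (All.map (All.map <⇒≤) (Allₚ.++⁻ˡ l B<A)))
      ( Blocks-snoc r bl r<m (All.zipWith (λ (x<m , x≤r) → <⇒≤ x<m ∷ x≤r) (l<m , l≤r))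
      , All-insert l B<A B<m , Anyₚ.++⁺ʳ l (here B<m) , dec))
      where
      l<m = Allₚ.++⁻ˡ l A<m
      r<m = Allₚ.++⁻ʳ l A<m
    bad : ∀ l r → l ++ r ≡ A → ¬ All (λ x → All (x ≤_) r) l → weight (word (l ++ m ∷ r) B) ≡ 0
    bad l r refl ¬l≤r = weight-bad (l ++ m ∷ r) B (λ av′ → ¬l≤r (proj₁ (insertˡ⁻ l (Allₚ.++⁻ˡ l A<m) B<m av′)))

-- Enumeration of the valid words

letters : ℕ → List Letter
letters zero    = [ nothing ]
letters (suc m) = just m ∷ letters m

validWords : ℕ → List (List Letter)
validWords zero    = [ [ nothing ] ]
validWords (suc m) = concatMap (children m) (validWords m)

data LetterBelow (m : ℕ) : Letter → Set where
  nothing : LetterBelow m nothing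
  just    : ∀ {v} → v < m → LetterBelow m (just v)

letters-below : ∀ m → All (LetterBelow m) (letters m)
letters-below zero    = nothing ∷ []
letters-below (suc m) = just ≤-refl ∷ All.map raise (letters-below m)
  where
  raise : ∀ {x} → LetterBelow m x → LetterBelow (suc m) x
  raise nothing    = nothing
  raise (just v<m) = just (m<n⇒m<1+n v<m)

fresh : ∀ {m w} → w ↭ letters m → All (_≢ just m) w
fresh {m} p = All.map (λ { (just v<m) refl → <-irrefl refl v<m }) (All-resp-↭ (↭-sym p) (letters-below m))

inserts⁻ : ∀ {X : Set} {x : X} w {z} → z ∈ inserts x w → ∃[ l ] ∃[ r ] (l ++ r ≡ w × z ≡ l ++ x ∷ r)
inserts⁻ []      (here refl) = [] , [] , refl , refl
inserts⁻ (y ∷ w) (here refl) = [] , y ∷ w , refl , refl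
inserts⁻ (y ∷ w) (there p) with ∈-map⁻ (y ∷_) p
... | _ , q , refl with inserts⁻ w q
... | l , r , refl , refl = y ∷ l , r , refl , refl

inserts⁺ : ∀ {X : Set} (x : X) l r → l ++ x ∷ r ∈ inserts x (l ++ r)
inserts⁺ x []      []      = here refl
inserts⁺ x []      (_ ∷ _) = here refl
inserts⁺ x (y ∷ l) r       = there (∈-map⁺ (y ∷_) (inserts⁺ x l r))

inserts-unique : ∀ {X : Set} {x : X} {w} → All (_≢ x) w → Unique (inserts x w)
inserts-unique []               = [] ∷ []
inserts-unique {w = y ∷ w} (y≢x ∷ p) =
  Allₚ.map⁺ (All.universal (λ _ e → y≢x (sym (∷-injectiveˡ e))) _) ∷ Uniqueₚ.map⁺ ∷-injectiveʳ (inserts-unique p)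

children⁻ : ∀ {m w z} → z ∈ children m w → (∃[ l ] ∃[ r ] (l ++ r ≡ w × z ≡ l ++ just m ∷ r)) × Valid z
children⁻ {m} {w} p with ∈-filter⁻ valid? {xs = inserts (just m) w} p
... | q , v = inserts⁻ w q , v

validWords-sound : ∀ m {w} → w ∈ validWords m → w ↭ letters m × Valid w
validWords-sound zero (here refl) = ↭-refl , [] ∷ []
validWords-sound (suc m) p with find (∈-concatMap⁻ (children m) {xs = validWords m} p)
... | w , w∈ , q = extend (validWords-sound m w∈) (children⁻ q)
  where
  extend : ∀ {w z} → w ↭ letters m × Valid w →
           (∃[ l ] ∃[ r ] (l ++ r ≡ w × z ≡ l ++ just m ∷ r)) × Valid z → z ↭ letters (suc m) × Valid z
  extend (p , _) ((l , r , refl , refl) , v) = ↭-trans (shift (just m) l r) (prep (just m) p) , v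

validWords-complete : ∀ m {w} → w ↭ letters m → Valid w → w ∈ validWords m
validWords-complete zero    p v rewrite ↭-singleton-inv p = here refl
validWords-complete (suc m) {w} p v with ∈-∃++ (∈-resp-↭ (↭-sym p) (here refl))
... | l , r , refl = ∈-concatMap⁺ (children m) (lift (validWords-complete m
        (drop-∷ (↭-trans (↭-sym (shift (just m) l r)) p)) (AllQuads-delete l v)))
  where
  lift : ∀ {xs} → l ++ r ∈ xs → Any (λ w → (l ++ just m ∷ r) ∈ children m w) xs
  lift = Any.map (λ { refl → ∈-filter⁺ valid? (inserts⁺ (just m) l r) v })

validWords-unique : ∀ m → Unique (validWords m)
validWords-unique zero    = [] ∷ []
validWords-unique (suc m) = Uniqueₚ.concat⁺
  (Allₚ.map⁺ (All.map (Uniqueₚ.filter⁺ valid? ∘ inserts-unique) allFresh))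
  (AllPairsₚ.map⁺ (AllPairs-map-All (λ f f′ w≢w′ {z} q → w≢w′ (trans (sym (strip f (proj₁ q))) (strip f′ (proj₂ q)))) allFresh (validWords-unique m)))
  where
  allFresh : All (λ w → All (_≢ just m) w) (validWords m)
  allFresh = All.tabulate (λ p → fresh (proj₁ (validWords-sound m p)))
  other? : ∀ (x : Letter) → Dec (x ≢ just m)
  other? x = ¬? (≡-dec _≟_ x (just m))
  -- Deleting `just m` recovers the parent, so different parents have disjoint lists of children.
  strip : ∀ {w z} → All (_≢ just m) w → z ∈ children m w → filter other? z ≡ w
  strip {w} f p with children⁻ {m} {w} p
  ... | (l , r , refl , refl) , _ = trans (filter-++ other? l (just m ∷ r))
    (cong₂ _++_ (filter-all other? (Allₚ.++⁻ˡ l f))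
                (trans (filter-reject other? {x = just m} {xs = r} (λ n → n refl)) (filter-all other? (Allₚ.++⁻ʳ l f))))

sum-concatMap : ∀ {X Y : Set} (g : Y → ℕ) (f : X → List Y) xs →
                sum (map g (concatMap f xs)) ≡ sum (map (λ x → sum (map g (f x))) xs)
sum-concatMap g f []       = refl
sum-concatMap g f (x ∷ xs) = trans (cong sum (map-++ g (f x) (concatMap f xs)))
  (trans (sum-++ (map g (f x)) _) (cong (sum (map g (f x)) +_) (sum-concatMap g f xs)))

-- Each step trades one enumerated level for one more level of `descend`, until only the root is
-- left.
validWords-descend : ∀ m k → sum (map (descend k m) (validWords m)) ≡ descend (m + k) 0 [ nothing ]
validWords-descend zero    k = +-identityʳ _
validWords-descend (suc m) k =
  trans (sum-concatMap (descend k (suc m)) (children m) (validWords m))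
  (trans (validWords-descend m (suc k)) (cong (λ z → descend z 0 [ nothing ]) (+-suc m k)))

length≡sum : ∀ {X : Set} (xs : List X) → length xs ≡ sum (map (λ _ → 1) xs)
length≡sum []       = refl
length≡sum (x ∷ xs) = cong suc (length≡sum xs)

root-inv : Inv 0 (leftEmpty true 0) [] []
root-inv = inv [] [] (avoiding [] [] [] []) (refl , whole [] [] [] [] [])

validWords-length : ∀ m → length (validWords m) ≡ descendants m (leftEmpty true 0)
validWords-length m = trans (length≡sum (validWords m)) (trans (validWords-descend m 0)
  (trans (cong (λ z → descend z 0 [ nothing ]) (+-identityʳ m)) (descend≡descendants m root-inv)))

validWords-card : ∀ m → HasCard (λ w → w ↭ letters m × Valid w) (descendants m (leftEmpty true 0))
validWords-card m = validWords m , validWords-unique m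
  , (λ w → mk⇔ (validWords-sound m) (λ (p , v) → validWords-complete m p v)) , validWords-length m

HasCard-preimage : ∀ {X Y : Set} {P : X → Set} {Q : Y → Set} {c} (f : X → Y) → (∀ {x y} → f x ≡ f y → x ≡ y) →
                   (∀ x → P x → Q (f x)) → (∀ y → Q y → ∃[ x ] (f x ≡ y × P x)) → HasCard Q c → HasCard P c
HasCard-preimage {P = P} {Q} f inj to from (ys , ys! , ys≡Q , len) with build ys (λ y y∈ → Equivalence.to (ys≡Q y) y∈)
  where
  build : ∀ ys → (∀ y → y ∈ ys → Q y) → ∃[ xs ] (map f xs ≡ ys × All P xs)
  build []       q = [] , refl , []
  build (y ∷ ys) q with from y (q y (here refl)) | build ys (λ z z∈ → q z (there z∈))
  ... | x , refl , p | xs , refl , ps = x ∷ xs , refl , p ∷ ps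
... | xs , refl , ps = xs , Uniqueₚ.map⁻ ys!
  , (λ x → mk⇔ (All.lookup ps) (λ p → back (∈-map⁻ f (Equivalence.from (ys≡Q (f x)) (to x p)))))
  , trans (sym (length-map f xs)) len
  where
  back : ∀ {x} → ∃[ y ] (y ∈ xs × f x ≡ f y) → x ∈ xs
  back (y , y∈ , e) rewrite inj e = y∈

-- Words as lists of letters

toLetters : ∀ {m n} → Vec (Maybe (Fin m)) n → List Letter
toLetters []      = []
toLetters (x ∷ π) = Maybe.map toℕ x ∷ toLetters π

toLetters-injective : ∀ {m n} {π ρ : Vec (Maybe (Fin m)) n} → toLetters π ≡ toLetters ρ → π ≡ ρ
toLetters-injective {π = []}    {[]}    e = refl
toLetters-injective {π = _ ∷ _} {_ ∷ _} e =
  cong₂ _∷_ (map-injective Finₚ.toℕ-injective (∷-injectiveˡ e)) (toLetters-injective (∷-injectiveʳ e))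

length-toLetters : ∀ {m n} (π : Vec (Maybe (Fin m)) n) → length (toLetters π) ≡ n
length-toLetters []      = refl
length-toLetters (x ∷ π) = cong suc (length-toLetters π)

lookup-toLetters : ∀ {m n} (π : Vec (Maybe (Fin m)) n) i → Maybe.map toℕ (lookup π i) ∈ toLetters π
lookup-toLetters (x ∷ π) zero    = here refl
lookup-toLetters (x ∷ π) (suc i) = there (lookup-toLetters π i)

toLetters-lookup : ∀ {m n} (π : Vec (Maybe (Fin m)) n) x → Maybe.map toℕ x ∈ toLetters π → ∃[ i ] lookup π i ≡ x
toLetters-lookup (y ∷ π) x (here e)  = zero , sym (map-injective Finₚ.toℕ-injective e)
toLetters-lookup (y ∷ π) x (there p) with toLetters-lookup π x p
... | i , e = suc i , e

lookup-unique : ∀ {m n} (π : Vec (Maybe (Fin m)) n) → Unique (toLetters π) → ∀ i j → lookup π i ≡ lookup π j → i ≡ j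
lookup-unique (x ∷ π) (p ∷ ps) zero    zero    e = refl
lookup-unique (x ∷ π) (p ∷ ps) zero    (suc j) e =
  ⊥-elim (All.lookup p (lookup-toLetters π j) (cong (Maybe.map toℕ) e))
lookup-unique (x ∷ π) (p ∷ ps) (suc i) zero    e =
  ⊥-elim (All.lookup p (lookup-toLetters π i) (cong (Maybe.map toℕ) (sym e)))
lookup-unique (x ∷ π) (p ∷ ps) (suc i) (suc j) e = cong suc (lookup-unique π ps i j e)

fromLetters : ∀ {m} n w → length w ≡ n → All (LetterBelow m) w → ∃[ π ] toLetters {m} {n} π ≡ w
fromLetters zero    []      _ []       = [] , refl
fromLetters (suc n) (x ∷ w) e (b ∷ bs) with fromLetters n w (suc-injective e) bs
fromLetters (suc n) (.nothing ∷ w)  e (nothing ∷ bs)  | π , p = nothing ∷ π , cong (nothing ∷_) p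
fromLetters (suc n) (.(just _) ∷ w) e (just v<m ∷ bs) | π , p =
  just (fromℕ< v<m) ∷ π , cong₂ (λ a b → just a ∷ b) (Finₚ.toℕ-fromℕ< v<m) p

-- Pigeonhole: taking out one copy of `just m` leaves a list one shorter that still holds all
-- smaller letters and the hole; at the end the hole stands alone.
letters-complete : ∀ m w → length w ≡ suc m → nothing ∈ w → (∀ v → v < m → just v ∈ w) → w ↭ letters m
letters-complete zero    (.nothing ∷ []) _ (here refl) _ = ↭-refl
letters-complete (suc m) w e h vs with ∈-∃++ (vs m ≤-refl)
... | l , r , refl = ↭-trans (shift (just m) l r) (prep (just m) (letters-complete m (l ++ r) len
        (other (λ ()) h) (λ v v<m → other (λ { refl → <-irrefl refl v<m }) (vs v (m<n⇒m<1+n v<m)))))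
  where
  len : length (l ++ r) ≡ suc m
  len = suc-injective (trans (sym (↭-length (shift (just m) l r))) e)
  other : ∀ {x} → x ≢ just m → x ∈ l ++ just m ∷ r → x ∈ l ++ r
  other x≢ p with Anyₚ.++⁻ l p
  ... | inj₁ q         = Anyₚ.++⁺ˡ q
  ... | inj₂ (here q)  = ⊥-elim (x≢ q)
  ... | inj₂ (there q) = Anyₚ.++⁺ʳ l q

letters-unique : ∀ m → Unique (letters m)
letters-unique zero    = [] ∷ []
letters-unique (suc m) = All.map (λ n e → n (sym e)) (fresh ↭-refl) ∷ letters-unique m

letters-length : ∀ m → length (letters m) ≡ suc m
letters-length zero    = refl
letters-length (suc m) = cong suc (letters-length m)

nothing∈letters : ∀ m → nothing ∈ letters m
nothing∈letters zero    = here refl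
nothing∈letters (suc m) = there (nothing∈letters m)

just∈letters : ∀ m {v} → v < m → just v ∈ letters m
just∈letters (suc m) {v} (s≤s v≤m) with m≤n⇒m<n∨m≡n v≤m
... | inj₁ v<m  = there (just∈letters m v<m)
... | inj₂ refl = here refl

IsPartialPerm1⇒letters : ∀ {m} (π : Word m) → IsPartialPerm1 m π → toLetters π ↭ letters m
IsPartialPerm1⇒letters {m} π ((h , eh , _) , pos) = letters-complete m (toLetters π) (length-toLetters π)
  (subst (λ x → Maybe.map toℕ x ∈ toLetters π) eh (lookup-toLetters π h))
  (λ v v<m → let i , e , _ = pos (fromℕ< v<m) in
    subst (_∈ toLetters π) (trans (cong (Maybe.map toℕ) e) (cong just (Finₚ.toℕ-fromℕ< v<m))) (lookup-toLetters π i))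

letters⇒IsPartialPerm1 : ∀ {m} (π : Word m) → toLetters π ↭ letters m → IsPartialPerm1 m π
letters⇒IsPartialPerm1 {m} π p =
    position nothing (nothing∈letters m)
  , λ v → position (just v) (just∈letters m (Finₚ.toℕ<n v))
  where
  unique : Unique (toLetters π)
  unique = Permₛ.Unique-resp-↭ (setoid Letter) (↭⇒↭ₛ (↭-sym p)) (letters-unique m)
  position : ∀ x → Maybe.map toℕ x ∈ letters m → ∃[ i ] (lookup π i ≡ x × (∀ j → lookup π j ≡ x → j ≡ i))
  position x x∈ with toLetters-lookup π x (∈-resp-↭ (↭-sym p) x∈)
  ... | i , e = i , e , λ j e′ → lookup-unique π unique j i (trans e′ (sym e))

letters⇒word : ∀ m w → w ↭ letters m → ∃[ π ] toLetters {m} {suc m} π ≡ w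
letters⇒word m w p = fromLetters (suc m) w (trans (↭-length p) (letters-length m)) (All-resp-↭ (↭-sym p) (letters-below m))

-- Conditions on positions against conditions on lists

module _ {m : ℕ} where

  private
    at : ∀ {n} → Vec (Maybe (Fin m)) n → Fin n → Letter
    at π i = Maybe.map toℕ (lookup π i)

  All⁺ : ∀ {P : Letter → Set} {n} (π : Vec (Maybe (Fin m)) n) → (∀ i → P (at π i)) → All P (toLetters π)
  All⁺ []      f = []
  All⁺ (x ∷ π) f = f zero ∷ All⁺ π (λ i → f (suc i))

  All⁻ : ∀ {P : Letter → Set} {n} (π : Vec (Maybe (Fin m)) n) → All P (toLetters π) → ∀ i → P (at π i)
  All⁻ π p i = All.lookup p (lookup-toLetters π i)

  AllPairs⁺ : ∀ {R : Letter → Letter → Set} {n} (π : Vec (Maybe (Fin m)) n) →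
              (∀ i j → i Fin.< j → R (at π i) (at π j)) → AllPairs R (toLetters π)
  AllPairs⁺ []      f = []
  AllPairs⁺ (x ∷ π) f = All⁺ π (λ j → f zero (suc j) (s≤s z≤n)) ∷ AllPairs⁺ π (λ i j p → f (suc i) (suc j) (s≤s p))

  AllPairs⁻ : ∀ {R : Letter → Letter → Set} {n} (π : Vec (Maybe (Fin m)) n) → AllPairs R (toLetters π) →
              ∀ i j → i Fin.< j → R (at π i) (at π j)
  AllPairs⁻ (x ∷ π) (p ∷ ps) zero    (suc j) _       = All⁻ π p j
  AllPairs⁻ (x ∷ π) (p ∷ ps) (suc i) (suc j) (s≤s q) = AllPairs⁻ π ps i j q

  AllTriples⁺ : ∀ {R : Letter → Letter → Letter → Set} {n} (π : Vec (Maybe (Fin m)) n) →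
                (∀ i j k → i Fin.< j → j Fin.< k → R (at π i) (at π j) (at π k)) → AllTriples R (toLetters π)
  AllTriples⁺ []      f = []
  AllTriples⁺ (x ∷ π) f = AllPairs⁺ π (λ j k p → f zero (suc j) (suc k) (s≤s z≤n) (s≤s p))
                        ∷ AllTriples⁺ π (λ i j k p q → f (suc i) (suc j) (suc k) (s≤s p) (s≤s q))

  AllTriples⁻ : ∀ {R : Letter → Letter → Letter → Set} {n} (π : Vec (Maybe (Fin m)) n) → AllTriples R (toLetters π) →
                ∀ i j k → i Fin.< j → j Fin.< k → R (at π i) (at π j) (at π k)
  AllTriples⁻ (x ∷ π) (p ∷ ps) zero    (suc j) (suc k) _       (s≤s r) = AllPairs⁻ π p j k r
  AllTriples⁻ (x ∷ π) (p ∷ ps) (suc i) (suc j) (suc k) (s≤s q) (s≤s r) = AllTriples⁻ π ps i j k q r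

  AllQuads⁺ : ∀ {R : Letter → Letter → Letter → Letter → Set} {n} (π : Vec (Maybe (Fin m)) n) →
              (∀ i j k l → i Fin.< j → j Fin.< k → k Fin.< l → R (at π i) (at π j) (at π k) (at π l)) →
              AllQuads R (toLetters π)
  AllQuads⁺ []      f = []
  AllQuads⁺ (x ∷ π) f = AllTriples⁺ π (λ j k l p q → f zero (suc j) (suc k) (suc l) (s≤s z≤n) (s≤s p) (s≤s q))
                      ∷ AllQuads⁺ π (λ i j k l p q r → f (suc i) (suc j) (suc k) (suc l) (s≤s p) (s≤s q) (s≤s r))

  AllQuads⁻ : ∀ {R : Letter → Letter → Letter → Letter → Set} {n} (π : Vec (Maybe (Fin m)) n) → AllQuads R (toLetters π) →
              ∀ i j k l → i Fin.< j → j Fin.< k → k Fin.< l → R (at π i) (at π j) (at π k) (at π l)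
  AllQuads⁻ (x ∷ π) (p ∷ ps) zero    (suc j) (suc k) (suc l) _       (s≤s b) (s≤s c) = AllTriples⁻ π p j k l b c
  AllQuads⁻ (x ∷ π) (p ∷ ps) (suc i) (suc j) (suc k) (suc l) (s≤s a) (s≤s b) (s≤s c) = AllQuads⁻ π ps i j k l a b c

-- Extensions of a partial permutation

module _ {X : Set} {P Q : X → Set} (P? : Decidable P) (Q? : Decidable Q) (P⇒Q : ∀ {x} → P x → Q x) where

  filter-length-≤ : ∀ xs → length (filter P? xs) ≤ length (filter Q? xs)
  filter-length-≤ []       = z≤n
  filter-length-≤ (x ∷ xs) with P? x | Q? x
  ... | yes p | yes q = s≤s (filter-length-≤ xs)
  ... | yes p | no ¬q = ⊥-elim (¬q (P⇒Q p))
  ... | no ¬p | yes q = m≤n⇒m≤1+n (filter-length-≤ xs)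
  ... | no ¬p | no ¬q = filter-length-≤ xs

  filter-length-< : ∀ {x xs} → x ∈ xs → ¬ P x → Q x → length (filter P? xs) < length (filter Q? xs)
  filter-length-< {x} {.x ∷ xs} (here refl) ¬p q
    rewrite filter-reject P? {x} {xs} ¬p | filter-accept Q? {x} {xs} q = s≤s (filter-length-≤ xs)
  filter-length-< {x} {y ∷ xs} (there x∈) ¬p q with P? y | Q? y
  ... | yes _  | yes _ = s≤s (filter-length-< x∈ ¬p q)
  ... | yes py | no ¬q = ⊥-elim (¬q (P⇒Q py))
  ... | no _   | yes _ = m≤n⇒m≤1+n (filter-length-< x∈ ¬p q)
  ... | no _   | no _  = filter-length-< x∈ ¬p q

module _ {m : ℕ} (π : Word m) (σ : Permutation′ (suc m)) where

  private
    LetterBelow? : ∀ i → Decidable (λ j → T (is-just (lookup π j) ∧ (toℕ (σ ⟨$⟩ʳ j) <ᵇ toℕ (σ ⟨$⟩ʳ i))))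
    LetterBelow? i j = T? _

    isJust : ∀ {i u} → lookup π i ≡ just u → T (is-just (lookup π i))
    isJust e = subst (λ x → T (is-just x)) (sym e) tt

    irrefl : ∀ {i} → ¬ T (is-just (lookup π i) ∧ (toℕ (σ ⟨$⟩ʳ i) <ᵇ toℕ (σ ⟨$⟩ʳ i)))
    irrefl {i} t = <-irrefl refl (<ᵇ⇒< (toℕ (σ ⟨$⟩ʳ i)) _ (proj₂ (Equivalence.to (T-∧ {is-just (lookup π i)}) t)))

  stdRank-mono : ∀ i j {u} → lookup π i ≡ just u → (σ ⟨$⟩ʳ i) Fin.< (σ ⟨$⟩ʳ j) → stdRank π σ i < stdRank π σ j
  stdRank-mono i j e i<j = filter-length-< (LetterBelow? i) (LetterBelow? j)
    (λ t → let a , b = Equivalence.to T-∧ t in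
      Equivalence.from T-∧ (a , <⇒<ᵇ (<-trans (<ᵇ⇒< _ _ b) i<j)))
    (∈-allFin i) irrefl (Equivalence.from T-∧ (isJust e , <⇒<ᵇ i<j))

  -- Two strict comparisons bring `suc m` down to `m`: position `i` is not below itself, and `h`
  -- holds no letter.
  stdRank-bound : ∀ h i {u} → lookup π h ≡ nothing → lookup π i ≡ just u → stdRank π σ i < m
  stdRank-bound h i eh e = ≤-pred (<-≤-trans (s≤s
    (filter-length-< (LetterBelow? i) (λ j → T? (is-just (lookup π j))) (λ t → proj₁ (Equivalence.to T-∧ t))
      (∈-allFin i) irrefl (isJust e)))
    (≤-trans (filter-length-< (λ j → T? (is-just (lookup π j))) (λ _ → yes tt) (λ _ → tt) (∈-allFin h)
        (subst (λ x → ¬ T (is-just x)) (sym eh) id) tt)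
      (≤-trans (length-filter (λ _ → yes tt) (allFin (suc m)))
                  (≤-reflexive (length-tabulate {n = suc m} id)))))

StrictMono : ∀ {m} → (Fin m → ℕ) → Set
StrictMono g = ∀ i j → i Fin.< j → g i < g j

StrictMono-lower : ∀ {m} (g : Fin (suc m) → ℕ) → StrictMono g → ∀ v → toℕ v + g zero ≤ g v
StrictMono-lower         g mono zero    = ≤-refl
StrictMono-lower {suc m} g mono (suc v) = ≤-trans
  (≤-trans (≤-reflexive (sym (+-suc (toℕ v) (g zero)))) (+-monoʳ-≤ (toℕ v) (mono zero (suc zero) (s≤s z≤n))))
  (StrictMono-lower (λ i → g (suc i)) (λ i j i<j → mono (suc i) (suc j) (s≤s i<j)) v)

StrictMono-upper : ∀ {m} (g : Fin m → ℕ) N → StrictMono g → (∀ v → g v < N) → ∀ v → m + g v ≤ N + toℕ v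
StrictMono-upper {suc zero}    g N mono b zero = ≤-trans (b zero) (m≤m+n N 0)
StrictMono-upper {suc (suc m)} g N mono b zero = ≤-trans
  (≤-trans (≤-reflexive (sym (+-suc (suc m) (g zero)))) (+-monoʳ-≤ (suc m) (mono zero (suc zero) (s≤s z≤n))))
  (StrictMono-upper (λ i → g (suc i)) N (λ i j i<j → mono (suc i) (suc j) (s≤s i<j)) (λ v → b (suc v)) zero)
StrictMono-upper {suc m} g N mono b (suc v) = ≤-trans
  (s≤s (StrictMono-upper (λ i → g (suc i)) N (λ i j i<j → mono (suc i) (suc j) (s≤s i<j)) (λ v → b (suc v)) v))
  (≤-reflexive (sym (+-suc N (toℕ v))))

-- This replaces counting in `isExtension`: the ranks of the letters increase strictly and stay
-- below `m`, so each rank is forced to equal its letter.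
StrictMono-bounded : ∀ {m} (g : Fin m → ℕ) → StrictMono g → (∀ v → g v < m) → ∀ v → g v ≡ toℕ v
StrictMono-bounded {suc m} g mono b v = ≤-antisym
  (+-cancelˡ-≤ (suc m) _ _ (StrictMono-upper g (suc m) mono b v))
  (≤-trans (m≤m+n (toℕ v) (g zero)) (StrictMono-lower g mono v))

punchIn-mono-< : ∀ {n} (c : Fin (suc n)) {u v} → u Fin.< v → punchIn c u Fin.< punchIn c v
punchIn-mono-< c {u} {v} u<v = ≰⇒> (λ le → <⇒≱ u<v (Finₚ.punchIn-cancel-≤ c v u le))

punchIn-below : ∀ {n} (c : Fin (suc n)) v → v Fin.< c → punchIn c v Fin.< c
punchIn-below (suc c) zero    _       = s≤s z≤n
punchIn-below (suc c) (suc v) (s≤s p) = s≤s (punchIn-below c v p)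

punchIn-above : ∀ {n} (c : Fin (suc n)) v → c Fin.≤ v → c Fin.< punchIn c v
punchIn-above zero    v       _       = s≤s z≤n
punchIn-above (suc c) (suc v) (s≤s p) = s≤s (punchIn-above c v p)

module Extend {m : ℕ} (π : Word m) (isPP : IsPartialPerm1 m π) (c : Fin (suc m)) where

  private
    h    = proj₁ (proj₁ isPP)
    π-h  = proj₁ (proj₂ (proj₁ isPP))
    h-unique = proj₂ (proj₂ (proj₁ isPP))
    pos : Fin m → Fin (suc m)
    pos v = proj₁ (proj₂ isPP v)
    π-pos : ∀ v → lookup π (pos v) ≡ just v
    π-pos v = proj₁ (proj₂ (proj₂ isPP v))
    pos-unique : ∀ v j → lookup π j ≡ just v → j ≡ pos v
    pos-unique v = proj₂ (proj₂ (proj₂ isPP v))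

    fill : Maybe (Fin m) → Fin (suc m)
    fill = maybe′ (punchIn c) c

    locate : ∀ j → Dec (c ≡ j) → Fin (suc m)
    locate j (yes _)  = h
    locate j (no c≢j) = pos (punchOut c≢j)

    fill-locate : ∀ j d → fill (lookup π (locate j d)) ≡ j
    fill-locate j (yes c≡j) rewrite π-h = c≡j
    fill-locate j (no c≢j)  rewrite π-pos (punchOut c≢j) = Finₚ.punchIn-punchOut c≢j

    locate-fill : ∀ i x d → lookup π i ≡ x → locate (fill x) d ≡ i
    locate-fill i nothing  (yes _)  e = sym (h-unique i e)
    locate-fill i nothing  (no c≢c) e = ⊥-elim (c≢c refl)
    locate-fill i (just v) (yes c≡) e = ⊥-elim (Finₚ.punchInᵢ≢i c v (sym c≡))
    locate-fill i (just v) (no c≢)  e = sym (pos-unique _ i (trans e (cong just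
      (Finₚ.punchIn-injective c _ _ (sym (Finₚ.punchIn-punchOut c≢))))))

  extension : Permutation′ (suc m)
  extension = permutation (λ i → fill (lookup π i)) (λ j → locate j (c Finₚ.≟ j))
    (λ j → fill-locate j (c Finₚ.≟ j)) (λ i → locate-fill i (lookup π i) (c Finₚ.≟ fill (lookup π i)) refl)

  extension-hole : ∀ {i} → lookup π i ≡ nothing → extension ⟨$⟩ʳ i ≡ c
  extension-hole e = cong fill e

  extension-just : ∀ {i v} → lookup π i ≡ just v → extension ⟨$⟩ʳ i ≡ punchIn c v
  extension-just e = cong fill e

  isExtension : IsExtension π extension
  isExtension i v e rewrite pos-unique v i e =
    StrictMono-bounded (λ v → stdRank π extension (pos v))
      (λ u w u<w → stdRank-mono π extension (pos u) (pos w) (π-pos u)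
        (subst₂ Fin._<_ (sym (extension-just (π-pos u))) (sym (extension-just (π-pos w))) (punchIn-mono-< c u<w)))
      (λ w → stdRank-bound π extension h (pos w) π-h (π-pos w)) v

-- Occurrences of 2413 in extensions against bad quadruples

order-2413 : (s : Fin 4 → ℕ) → s 2F < s 0F → s 0F < s 3F → s 3F < s 1F →
             ∀ a b → (lookup p2413 a < lookup p2413 b) ⇔ (s a < s b)
order-2413 s s₂₀ s₀₃ s₃₁ = table
  where
  s₂₃ = <-trans s₂₀ s₀₃
  s₀₁ = <-trans s₀₃ s₃₁
  s₂₁ = <-trans s₂₃ s₃₁
  below : ∀ {x y a b} {t : True (x <? y)} → s a < s b → (x < y) ⇔ (s a < s b)
  below {t = t} p = mk⇔ (λ _ → p) (λ _ → toWitness t)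
  above : ∀ {x y a b} {t : False (x <? y)} → s b < s a → (x < y) ⇔ (s a < s b)
  above {t = t} p = mk⇔ (λ q → ⊥-elim (toWitnessFalse t q)) (λ q → ⊥-elim (<-asym p q))
  same : ∀ {x a} → (x < x) ⇔ (s a < s a)
  same = mk⇔ (λ q → ⊥-elim (<-irrefl refl q)) (λ q → ⊥-elim (<-irrefl refl q))
  table : ∀ a b → (lookup p2413 a < lookup p2413 b) ⇔ (s a < s b)
  table 0F 0F = same
  table 0F 1F = below s₀₁
  table 0F 2F = above s₂₀
  table 0F 3F = below s₀₃
  table 1F 0F = above s₀₁
  table 1F 1F = same
  table 1F 2F = above s₂₁
  table 1F 3F = above s₃₁
  table 2F 0F = below s₂₀
  table 2F 1F = below s₂₁
  table 2F 2F = same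
  table 2F 3F = below s₂₃
  table 3F 0F = above s₀₃
  table 3F 1F = below s₃₁
  table 3F 2F = above s₂₃
  table 3F 3F = same

increasing-4 : ∀ {n} (v : Vec (Fin n) 4) → lookup v 0F Fin.< lookup v 1F → lookup v 1F Fin.< lookup v 2F →
               lookup v 2F Fin.< lookup v 3F → ∀ a b → a Fin.< b → lookup v a Fin.< lookup v b
increasing-4 v p q r 0F 1F _ = p
increasing-4 v p q r 0F 2F _ = <-trans p q
increasing-4 v p q r 0F 3F _ = <-trans p (<-trans q r)
increasing-4 v p q r 1F 2F _ = q
increasing-4 v p q r 1F 3F _ = <-trans q r
increasing-4 v p q r 2F 3F _ = r
increasing-4 v p q r 1F 1F (s≤s ())
increasing-4 v p q r 2F 1F (s≤s ())
increasing-4 v p q r 2F 2F (s≤s (s≤s ()))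
increasing-4 v p q r 3F 1F (s≤s ())
increasing-4 v p q r 3F 2F (s≤s (s≤s ()))
increasing-4 v p q r 3F 3F (s≤s (s≤s (s≤s ())))

contains-2413 : ∀ {n} (σ : Permutation′ n) i j k l → i Fin.< j → j Fin.< k → k Fin.< l →
                (σ ⟨$⟩ʳ k) Fin.< (σ ⟨$⟩ʳ i) → (σ ⟨$⟩ʳ i) Fin.< (σ ⟨$⟩ʳ l) → (σ ⟨$⟩ʳ l) Fin.< (σ ⟨$⟩ʳ j) →
                Contains p2413 σ
contains-2413 σ i j k l p q r a b c =
    lookup (i ∷ j ∷ k ∷ l ∷ []) , increasing-4 (i ∷ j ∷ k ∷ l ∷ []) p q r
  , order-2413 (λ x → toℕ (σ ⟨$⟩ʳ lookup (i ∷ j ∷ k ∷ l ∷ []) x)) a b c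

-- A bad quadruple becomes a 2413 for a suitable hole value. As a 4 the hole gets the largest value
-- and as a 1 the least. As a 2 or a 3 it gets the value of the next larger letter of the pattern,
-- which `punchIn` raises past it.
PAvoids⇒Valid : ∀ {m} (π : Word m) → IsPartialPerm1 m π → PAvoids p2413 π → Valid (toLetters π)
PAvoids⇒Valid {m} π isPP av = AllQuads⁺ π λ i j k l i<j j<k k<l →
  go i j k l i<j j<k k<l (lookup π i) (lookup π j) (lookup π k) (lookup π l) refl refl refl refl
  where
  module _ (i j k l : Fin (suc m)) (i<j : i Fin.< j) (j<k : j Fin.< k) (k<l : k Fin.< l) where
    contra : (c : Fin (suc m)) → let σ = Extend.extension π isPP c in
             ∀ {vᵢ vⱼ vₖ vₗ} → σ ⟨$⟩ʳ i ≡ vᵢ → σ ⟨$⟩ʳ j ≡ vⱼ → σ ⟨$⟩ʳ k ≡ vₖ → σ ⟨$⟩ʳ l ≡ vₗ →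
             vₖ Fin.< vᵢ → vᵢ Fin.< vₗ → vₗ Fin.< vⱼ → ⊥
    contra c refl refl refl refl p q r =
      av (Extend.extension π isPP c) (Extend.isExtension π isPP c) (contains-2413 (Extend.extension π isPP c) i j k l i<j j<k k<l p q r)

    go : ∀ a b c d → lookup π i ≡ a → lookup π j ≡ b → lookup π k ≡ c → lookup π l ≡ d →
         NotBad (Maybe.map toℕ a) (Maybe.map toℕ b) (Maybe.map toℕ c) (Maybe.map toℕ d)
    go nothing (just x) (just y) (just z) eᵢ eⱼ eₖ eₗ (hole-2 y<z z<x) =
      contra c (E.extension-hole eᵢ) (E.extension-just eⱼ) (E.extension-just eₖ) (E.extension-just eₗ)
        (punchIn-below c y (subst (toℕ y <_) (sym (Finₚ.toℕ-inject₁ z)) y<z))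
        (punchIn-above c z (≤-reflexive (Finₚ.toℕ-inject₁ z)))
        (punchIn-mono-< c z<x)
      where
      c = inject₁ z
      module E = Extend π isPP c
    go (just x) nothing (just y) (just z) eᵢ eⱼ eₖ eₗ (hole-4 y<x x<z) =
      contra c (E.extension-just eᵢ) (E.extension-hole eⱼ) (E.extension-just eₖ) (E.extension-just eₗ)
        (punchIn-mono-< c y<x)
        (punchIn-mono-< c x<z)
        (punchIn-below c z (subst (toℕ z <_) (sym (Finₚ.toℕ-fromℕ m)) (Finₚ.toℕ<n z)))
      where
      c = fromℕ m
      module E = Extend π isPP c
    go (just x) (just y) nothing (just z) eᵢ eⱼ eₖ eₗ (hole-1 x<z z<y) =
      contra zero (E.extension-just eᵢ) (E.extension-just eⱼ) (E.extension-hole eₖ) (E.extension-just eₗ)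
        (punchIn-above zero x z≤n) (punchIn-mono-< zero x<z) (punchIn-mono-< zero z<y)
      where
      module E = Extend π isPP zero
    go (just x) (just y) (just z) nothing eᵢ eⱼ eₖ eₗ (hole-3 z<x x<y) =
      contra c (E.extension-just eᵢ) (E.extension-just eⱼ) (E.extension-just eₖ) (E.extension-hole eₗ)
        (punchIn-mono-< c z<x)
        (punchIn-below c x (subst (toℕ x <_) (sym (Finₚ.toℕ-inject₁ y)) x<y))
        (punchIn-above c y (≤-reflexive (Finₚ.toℕ-inject₁ y)))
      where
      c = inject₁ y
      module E = Extend π isPP c
    go (just _) (just _) (just _) (just _) _ _ _ _ ()
    go nothing  nothing  _        _        _ _ _ _ ()
    go nothing  (just _) nothing  _        _ _ _ _ ()
    go nothing  (just _) (just _) nothing  _ _ _ _ ()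
    go (just _) nothing  nothing  _        _ _ _ _ ()
    go (just _) nothing  (just _) nothing  _ _ _ _ ()
    go (just _) (just _) nothing  nothing  _ _ _ _ ()

-- An occurrence through the hole is itself a bad quadruple. If it misses the hole, then the hole
-- lies before the 4, between the 4 and the 1, or after the 1; it replaces the 2, the 1 or the 3
-- respectively, and the order of the remaining three letters is what `Bad` asks for.
Valid⇒PAvoids : ∀ {m} (π : Word m) → IsPartialPerm1 m π → Valid (toLetters π) → PAvoids p2413 π
Valid⇒PAvoids {m} π ((h , eh , h-unique) , _) valid σ ext (f , inc , ord) =
  go (lookup π i) (lookup π j) (lookup π k) (lookup π l) refl refl refl refl
  where
  i = f 0F
  j = f 1F
  k = f 2F
  l = f 3F
  i<j = inc 0F 1F (s≤s z≤n)
  j<k = inc 1F 2F (s≤s (s≤s z≤n))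
  k<l = inc 2F 3F (s≤s (s≤s (s≤s z≤n)))
  rel : ∀ a b → {True (lookup p2413 a <? lookup p2413 b)} → (σ ⟨$⟩ʳ f a) Fin.< (σ ⟨$⟩ʳ f b)
  rel a b {t} = Equivalence.to (ord a b) (toWitness t)

  letters< : ∀ {p q u v} → lookup π p ≡ just u → lookup π q ≡ just v → (σ ⟨$⟩ʳ p) Fin.< (σ ⟨$⟩ʳ q) → u Fin.< v
  letters< {p} {q} {u} {v} ep eq p<q =
    subst₂ _<_ (ext p u ep) (ext q v eq) (stdRank-mono π σ p q ep p<q)

  notBad : ∀ {p q r s a b c d} → p Fin.< q → q Fin.< r → r Fin.< s →
           lookup π p ≡ a → lookup π q ≡ b → lookup π r ≡ c → lookup π s ≡ d →
           NotBad (Maybe.map toℕ a) (Maybe.map toℕ b) (Maybe.map toℕ c) (Maybe.map toℕ d)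
  notBad p<q q<r r<s refl refl refl refl = AllQuads⁻ π valid _ _ _ _ p<q q<r r<s

  oneHole : ∀ {p q} → p Fin.< q → lookup π p ≡ nothing → lookup π q ≡ nothing → ⊥
  oneHole p<q ep eq = <-irrefl (cong toℕ (trans (h-unique _ ep) (sym (h-unique _ eq)))) p<q

  differ : ∀ {p u} → lookup π p ≡ just u → h ≢ p
  differ e refl with trans (sym eh) e
  ... | ()

  go : ∀ a b c d → lookup π i ≡ a → lookup π j ≡ b → lookup π k ≡ c → lookup π l ≡ d → ⊥
  go nothing (just x) (just y) (just z) eᵢ eⱼ eₖ eₗ =
    notBad i<j j<k k<l eᵢ eⱼ eₖ eₗ (hole-2 (letters< eₖ eₗ (rel 2F 3F)) (letters< eₗ eⱼ (rel 3F 1F)))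
  go (just x) nothing (just y) (just z) eᵢ eⱼ eₖ eₗ =
    notBad i<j j<k k<l eᵢ eⱼ eₖ eₗ (hole-4 (letters< eₖ eᵢ (rel 2F 0F)) (letters< eᵢ eₗ (rel 0F 3F)))
  go (just x) (just y) nothing (just z) eᵢ eⱼ eₖ eₗ =
    notBad i<j j<k k<l eᵢ eⱼ eₖ eₗ (hole-1 (letters< eᵢ eₗ (rel 0F 3F)) (letters< eₗ eⱼ (rel 3F 1F)))
  go (just x) (just y) (just z) nothing eᵢ eⱼ eₖ eₗ =
    notBad i<j j<k k<l eᵢ eⱼ eₖ eₗ (hole-3 (letters< eₖ eᵢ (rel 2F 0F)) (letters< eᵢ eⱼ (rel 0F 1F)))
  -- The hole can take over the role of a letter of the occurrence next to it.
  go (just x) (just y) (just z) (just t) eᵢ eⱼ eₖ eₗ with Finₚ.<-cmp h j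
  ... | tri< h<j _ _ =
    notBad h<j j<k k<l eh eⱼ eₖ eₗ (hole-2 (letters< eₖ eₗ (rel 2F 3F)) (letters< eₗ eⱼ (rel 3F 1F)))
  ... | tri≈ _ h≡j _ = differ eⱼ h≡j
  ... | tri> _ _ j<h with Finₚ.<-cmp h k
  ... | tri< h<k _ _ =
    notBad i<j j<h (<-trans h<k k<l) eᵢ eⱼ eh eₗ (hole-1 (letters< eᵢ eₗ (rel 0F 3F)) (letters< eₗ eⱼ (rel 3F 1F)))
  ... | tri≈ _ h≡k _ = differ eₖ h≡k
  ... | tri> _ _ k<h =
    notBad i<j j<k k<h eᵢ eⱼ eₖ eh (hole-3 (letters< eₖ eᵢ (rel 2F 0F)) (letters< eᵢ eⱼ (rel 0F 1F)))
  go nothing  nothing  _        _        eᵢ eⱼ eₖ eₗ = oneHole i<j eᵢ eⱼ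
  go nothing  (just _) nothing  _        eᵢ eⱼ eₖ eₗ = oneHole (<-trans i<j j<k) eᵢ eₖ
  go nothing  (just _) (just _) nothing  eᵢ eⱼ eₖ eₗ = oneHole (<-trans i<j (<-trans j<k k<l)) eᵢ eₗ
  go (just _) nothing  nothing  _        eᵢ eⱼ eₖ eₗ = oneHole j<k eⱼ eₖ
  go (just _) nothing  (just _) nothing  eᵢ eⱼ eₖ eₗ = oneHole (<-trans j<k k<l) eⱼ eₗ
  go (just _) (just _) nothing  nothing  eᵢ eⱼ eₖ eₗ = oneHole k<l eₖ eₗ

theorem33 : (m : ℕ) →
    HasCard (λ (π : Word m) → IsPartialPerm1 m π × PAvoids p2413 π)
    ((2 * ((2 * suc m) C (suc m))) / (suc m + 1) ∸ 2 ^ m)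
theorem33 m = subst (HasCard _) (descendants-root m)
  (HasCard-preimage toLetters toLetters-injective
    (λ π (isPP , av) → IsPartialPerm1⇒letters π isPP , PAvoids⇒Valid π isPP av)
    back (validWords-card m))
  where
  back : ∀ w → w ↭ letters m × Valid w → ∃[ π ] (toLetters π ≡ w × (IsPartialPerm1 m π × PAvoids p2413 π))
  back w (p , valid) with letters⇒word m w p
  ... | π , refl = π , refl , letters⇒IsPartialPerm1 π p , Valid⇒PAvoids π (letters⇒IsPartialPerm1 π p) valid
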